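{- For all pairs of twin binary trees $J_0$ and $J_1$, we have $$\mathbf{E}_{J_0} \cdot \mathbf{E}_{J_1} = \mathbf{E}_{J_0 / J_1} \qquad\text{and}\qquad \mathbf{H}_{J_0} \cdot \mathbf{H}_{J_1} = \mathbf{H}_{J_0 \backslash J_1}.$$
   Context: $\mathbb{K}$ is a field of characteristic zero. $\mathfrak{S}$ is the set of all permutations (of all sizes $n\ge0$), seen as words; $\mathrm{std}(u)$ is the unique permutation of size $|u|$ with the same inversions as $u$. $\mathbf{FQSym}$ is the Hopf algebra over $\mathbb{K}$ with basis $\{\mathbf{F}_\sigma\}_{\sigma\in\mathfrak{S}}$, product $\mathbf{F}_\sigma\cdot\mathbf{F}_\nu = \sum_{\pi} \mathbf{F}_\pi$, where $\pi$ runs over all shuffles of $\sigma$ with the word obtained by adding $|\sigma|$ to every letter of $\nu$, and coproduct $\Delta(\mathbf{F}_\sigma) = \sum_{\sigma = uv} \mathbf{F}_{\mathrm{std}(u)} \otimes \mathbf{F}_{\mathrm{std}(v)}$. A binary tree is either a leaf (empty tree) or a node with a left and a right binary subtree. The canopy of a binary tree with $n$ nodes is the word of length $n-1$ obtained by reading its leaves from left to right except the first and the last, writing $0$ if the leaf is a right child and $1$ if it is a left child. A pair of twin binary trees is a pair of binary trees with the same number $n$ of nodes whose canopies differ at every position $1\le i\le n-1$. For a permutation $\sigma$, $\mathsf{P}(\sigma) = (T_L,T_R)$ where $T_L$ (resp. $T_R$) is the shape of the binary search tree obtained by inserting the letters of $\sigma$ from left to right (resp. right to left) with the standard binary search tree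 leaf insertion. $\mathbf{Baxter}$ is the Hopf subalgebra of $\mathbf{FQSym}$ with basis $\{\mathbf{P}_J\}$ indexed by pairs of twin binary trees, where $\mathbf{P}_J = \sum_{\sigma\in\mathfrak{S},\ \mathsf{P}(\sigma) = J} \mathbf{F}_\sigma$. The permutohedron order $\leq_{\mathrm{P}}$ on permutations of size $n$ is the partial order in which $\sigma$ is covered by $\nu$ iff $\sigma = u\,ab\,v$ and $\nu = u\,ba\,v$ for some words $u,v$ and letters $a<b$. The Baxter order on pairs of twin binary trees with $n$ nodes is defined by $J_0 \leq_{\mathrm{B}} J_1$ iff there are permutations $\sigma \leq_{\mathrm{P}} \nu$ of size $n$ with $\mathsf{P}(\sigma) = J_0$ and $\mathsf{P}(\nu) = J_1$. The elementary and homogeneous families of $\mathbf{Baxter}$ are $\mathbf{E}_J := \sum_{J \leq_{\mathrm{B}} J'} \mathbf{P}_{J'}$ and $\mathbf{H}_J := \sum_{J' \leq_{\mathrm{B}} J} \mathbf{P}_{J'}$. For binary trees $T_0,T_1$, $T_0 / T_1$ is obtained by grafting $T_0$ from its root on the leftmost leaf of $T_1$, and $T_0 \backslash T_1$ by grafting $T_1$ from its root on the rightmost leaf of $T_0$. For pairs of twin binary trees $J_0 = (T^0_L,T^0_R)$ and $J_1 = (T^1_L,T^1_R)$, $J_0 / J_1 := (T^0_L \backslash T^1_L,\ T^0_R / T^1_R)$ and $J_0 \backslash J_1 := (T^0_L / T^1_L,\ T^0_R \backslash T^1_R)$; these are pairs of twin binary trees. -}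

module Defs where

open import Algebra.Apartness.Bundles using (HeytingField)
open import Data.Bool.Base using (Bool; true; false; if_then_else_)
open import Data.List.Base using
  ( List; []; _∷_; [_]; _++_; _∷ʳ_; map; concatMap; foldl; foldr; filter; drop; take
  ; length; mapMaybe; upTo; applyUpTo; cartesianProduct; cartesianProductWith )
open import Data.List.Membership.Propositional using (_∈_; find; lose)
open import Data.List.Membership.Propositional.Properties using
  ( ∈-∃++; ∈-cartesianProduct⁺; ∈-cartesianProductWith⁺; ∈-map⁺; ∈-map⁻; ∈-++⁺ʳ; ∈-++⁻ )
open import Data.List.Properties using
  ( ++-assoc; ++-identityʳ; length-++; length-applyUpTo; map-applyUpTo; map-upTo; ≡-dec )
open import Data.List.Relation.Binary.Permutation.Propositional using
  ( _↭_; prep; swap; ↭-refl; ↭-sym; ↭-trans; ↭-reflexive )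
open import Data.List.Relation.Binary.Permutation.Propositional.Properties using
  ( ∈-resp-↭; ↭-length; drop-∷; shift; ++⁺; map⁺; filter-↭; ++⁺ˡ )
open import Data.List.Relation.Binary.Pointwise using (Pointwise; []; _∷_; decidable)
  renaming (++⁺ to pointwise-++⁺)
open import Data.List.Relation.Ternary.Interleaving.Propositional using
  ( Interleaving; []; consˡ; consʳ; toPermutation )
open import Data.List.Relation.Unary.All using (All; []; _∷_; tabulate)
open import Data.List.Relation.Unary.Any using (Any; here; any?)
import Data.List.Relation.Unary.Any.Properties as Any
import Data.Maybe.Base as Maybe
import Data.Maybe.Relation.Unary.Any as MaybeAny
open import Data.Nat.Base using (ℕ; zero; suc; _+_; _≤_; _<_; s≤s)
open import Data.Nat.Properties using
  ( _≟_; _<?_; _≤?_; +-suc; suc-injective; +-mono-≤-<; ≤-refl; ≤-reflexive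
  ; <-≤-trans; ≤-trans; <⇒≯; ≤-pred; +-assoc; +-comm; +-identityʳ )
open import Data.Product.Base using (∃; ∃₂; _×_; _,_; proj₁; proj₂)
open import Data.Product.Properties using () renaming (≡-dec to ×-≡-dec)
open import Data.Sum.Base using (_⊎_; inj₁; inj₂)
open import Data.Tree.Binary using (Tree; leaf; node; #nodes; mapₙ)
open import Data.Unit.Base using (⊤; tt)
open import Function.Base using (_∘_; const)
open import Relation.Binary.Construct.Closure.ReflexiveTransitive using (Star; ε; _◅_)
open import Relation.Binary.Definitions using (DecidableEquality)
open import Relation.Binary.PropositionalEquality using
  ( _≡_; _≢_; refl; sym; trans; cong; cong₂; subst; subst₂; module ≡-Reasoning )
open import Relation.Nullary.Decidable using
  ( Dec; yes; no; does; dec⇒maybe; map′; _×-dec_; _⊎-dec_; ¬?; recompute; dec-true; dec-false )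
open import Relation.Nullary.Negation using (¬_; contradiction)
open import Relation.Unary using () renaming (Decidable to Decidable₁)

private variable
  m n : ℕ

range : ℕ → List ℕ
range n = map suc (upTo n)

-- The word σ(1) σ(2) … σ(n).  The proof is irrelevant, so that two
-- permutations are equal as soon as their words are.
record 𝔖 (n : ℕ) : Set where
  constructor perm
  field
    word    : List ℕ
    .isPerm : word ↭ range n

open 𝔖 public

infix 4 _≟ʷ_ _∈ʷ?_ _↭?_

_≟ʷ_ : DecidableEquality (List ℕ)
_≟ʷ_ = ≡-dec _≟_

_∈ʷ?_ : ∀ a (w : List ℕ) → Dec (a ∈ w)
a ∈ʷ? w = any? (a ≟_) w

_↭?_ : ∀ (v w : List ℕ) → Dec (v ↭ w)
[]      ↭? []      = yes ↭-refl
[]      ↭? (b ∷ w) = no λ p → contradiction (↭-length p) λ ()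
(a ∷ v) ↭? w with a ∈ʷ? w
... | no a∉w = no λ p → a∉w (∈-resp-↭ p (here refl))
... | yes a∈w with ∈-∃++ a∈w
... | x , y , refl = map′
  (λ p → ↭-trans (prep a p) (↭-sym (shift a x y)))
  (λ p → drop-∷ (↭-trans p (shift a x y)))
  (v ↭? (x ++ y))

words : ∀ {A : Set} → ℕ → List A → List (List A)
words zero    as = [ [] ]
words (suc k) as = cartesianProductWith _∷_ as (words k as)

permutations : ∀ n → List (𝔖 n)
permutations n = mapMaybe
  (λ w → Maybe.map (λ p → perm w p) (dec⇒maybe (w ↭? range n)))
  (words n (range n))

∈-words : ∀ {A : Set} {as : List A} w → All (_∈ as) w → w ∈ words (length w) as
∈-words []      []       = here refl
∈-words (a ∷ w) (p ∷ ps) = ∈-cartesianProductWith⁺ _∷_ p (∈-words w ps)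

length-range : ∀ n → length (range n) ≡ n
length-range n = trans (cong length (map-upTo suc n)) (length-applyUpTo suc n)

applyUpTo-+ : ∀ {A : Set} (f g : ℕ → A) m n → (∀ i → f (m + i) ≡ g i) →
              applyUpTo f (m + n) ≡ applyUpTo f m ++ applyUpTo g n
applyUpTo-+ f g zero    zero    h = refl
applyUpTo-+ f g zero    (suc n) h =
  cong₂ _∷_ (h 0) (applyUpTo-+ (f ∘ suc) (g ∘ suc) zero n (h ∘ suc))
applyUpTo-+ f g (suc m) n       h = cong (f 0 ∷_) (applyUpTo-+ (f ∘ suc) g m n h)

range-+ : ∀ m n → range (m + n) ≡ range m ++ map (m +_) (range n)
range-+ m n
  rewrite map-upTo suc (m + n) | map-upTo suc m | map-upTo suc n
        | map-applyUpTo suc (m +_) n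
  = applyUpTo-+ suc ((m +_) ∘ suc) m n (λ i → sym (+-suc m i))

∈-permutations : (σ : 𝔖 n) → σ ∈ permutations n
∈-permutations {n} (perm w p) =
  Any.mapMaybe⁺ _ (words n (range n)) (Any.map⁺ (lose w∈ found))
  where
  p′ : w ↭ range n
  p′ = recompute (w ↭? range n) p
  w∈ : w ∈ words n (range n)
  w∈ = subst (λ k → w ∈ words k (range n)) (trans (↭-length p′) (length-range n))
         (∈-words w (tabulate (∈-resp-↭ p′)))
  found : MaybeAny.Any (perm w p ≡_)
            (Maybe.map (λ q → perm w q) (dec⇒maybe (w ↭? range n)))
  found with w ↭? range n
  ... | yes _ = MaybeAny.just refl
  ... | no ¬p = contradiction p′ ¬p

infix 4 _⋖_ _≤P_

data _⋖_ : List ℕ → List ℕ → Set where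
  exchange : ∀ u {a b} v → a < b → (u ++ a ∷ b ∷ v) ⋖ (u ++ b ∷ a ∷ v)

-- A word that covers a permutation of 1 … n is again one, so closing the
-- covering relation on words agrees with closing it on permutations.
_≤P_ : 𝔖 n → 𝔖 n → Set
σ ≤P ν = Star _⋖_ (word σ) (word ν)

-- Decidability, needed for the sums below: only finitely many words cover a
-- given one, and each of them has one non-inversion less.

covers : List ℕ → List (List ℕ)
covers []          = []
covers (a ∷ [])    = []
covers (a ∷ b ∷ v) =
  (if does (a <? b) then [ b ∷ a ∷ v ] else []) ++ map (a ∷_) (covers (b ∷ v))

∈-if : ∀ {P A : Set} (d : Dec P) {x y : A} →
       y ∈ (if does d then [ x ] else []) → P × y ≡ x
∈-if (yes p) (here eq) = p , eq

∷-⋖ : ∀ a {w w′} → w ⋖ w′ → (a ∷ w) ⋖ (a ∷ w′)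
∷-⋖ a (exchange u v l) = exchange (a ∷ u) v l

covers-sound : ∀ w {w′} → w′ ∈ covers w → w ⋖ w′
covers-sound (a ∷ b ∷ v) q
  with ∈-++⁻ (if does (a <? b) then [ b ∷ a ∷ v ] else []) q
... | inj₁ r with ∈-if (a <? b) r
...   | a<b , refl = exchange [] v a<b
covers-sound (a ∷ b ∷ v) q | inj₂ r with ∈-map⁻ (a ∷_) r
...   | w″ , r′ , refl = ∷-⋖ a (covers-sound (b ∷ v) r′)

covers-complete : ∀ {w w′} → w ⋖ w′ → w′ ∈ covers w
covers-complete (exchange [] {a} {b} v a<b)
  rewrite dec-true (a <? b) a<b = here refl
covers-complete (exchange (x ∷ []) {a} {b} v a<b) =
  ∈-++⁺ʳ (if does (x <? a) then _ else [])
    (∈-map⁺ (x ∷_) (covers-complete (exchange [] v a<b)))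
covers-complete (exchange (x ∷ y ∷ u) v a<b) =
  ∈-++⁺ʳ (if does (x <? y) then _ else [])
    (∈-map⁺ (x ∷_) (covers-complete (exchange (y ∷ u) v a<b)))

above : ℕ → List ℕ → ℕ
above a w = length (filter (a <?_) w)

nonInversions : List ℕ → ℕ
nonInversions []      = 0
nonInversions (a ∷ w) = above a w + nonInversions w

above-↭ : ∀ a {v w} → v ↭ w → above a v ≡ above a w
above-↭ a p = ↭-length (filter-↭ (a <?_) p)

nonInversions-⋖ : ∀ {w w′} → w ⋖ w′ → nonInversions w′ < nonInversions w
nonInversions-⋖ (exchange (x ∷ u) {a} {b} v a<b) =
  +-mono-≤-< (≤-reflexive (above-↭ x (++⁺ˡ u (swap b a ↭-refl))))
             (nonInversions-⋖ (exchange u v a<b))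
nonInversions-⋖ (exchange [] {a} {b} v a<b)
  rewrite dec-true (a <? b) a<b | dec-false (b <? a) (<⇒≯ a<b)
  = s≤s (≤-reflexive (begin
      above b v + (above a v + nonInversions v) ≡⟨ +-assoc (above b v) _ _ ⟨
      above b v + above a v + nonInversions v   ≡⟨ cong (_+ nonInversions v) (+-comm (above b v) _) ⟩
      above a v + above b v + nonInversions v   ≡⟨ +-assoc (above a v) _ _ ⟩
      above a v + (above b v + nonInversions v) ∎))
  where open ≡-Reasoning

Reaches : ℕ → List ℕ → List ℕ → Set
Reaches zero    w′ w = w ≡ w′
Reaches (suc k) w′ w = w ≡ w′ ⊎ Any (Reaches k w′) (covers w)

reaches? : ∀ k w′ → Decidable₁ (Reaches k w′)
reaches? zero    w′ w = w ≟ʷ w′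
reaches? (suc k) w′ w = (w ≟ʷ w′) ⊎-dec any? (reaches? k w′) (covers w)

reaches-sound : ∀ k {w′ w} → Reaches k w′ w → Star _⋖_ w w′
reaches-sound zero    refl        = ε
reaches-sound (suc k) (inj₁ refl) = ε
reaches-sound (suc k) {w = w} (inj₂ r) with find r
... | _ , x∈ , r′ = covers-sound w x∈ ◅ reaches-sound k r′

reaches-complete : ∀ k {w w′} → nonInversions w ≤ k → Star _⋖_ w w′ → Reaches k w′ w
reaches-complete zero    _ ε       = refl
reaches-complete (suc k) _ ε       = inj₁ refl
reaches-complete zero    l (c ◅ _) = contradiction (<-≤-trans (nonInversions-⋖ c) l) λ ()
reaches-complete (suc k) l (c ◅ s) = inj₂ (lose (covers-complete c)
  (reaches-complete k (≤-pred (≤-trans (nonInversions-⋖ c) l)) s))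

_≤P?_ : (σ ν : 𝔖 n) → Dec (σ ≤P ν)
σ ≤P? ν = map′ (reaches-sound _) (reaches-complete _ ≤-refl)
  (reaches? (nonInversions (word σ)) (word ν) (word σ))

BT : Set
BT = Tree ⊤ ⊤

infix 4 _≟ᵗ_

_≟ᵗ_ : DecidableEquality BT
leaf _     ≟ᵗ leaf _       = yes refl
leaf _     ≟ᵗ node _ _ _   = no λ ()
node _ _ _ ≟ᵗ leaf _       = no λ ()
node l _ r ≟ᵗ node l′ _ r′ = map′
  (λ { (refl , refl) → refl }) (λ { refl → refl , refl })
  ((l ≟ᵗ l′) ×-dec (r ≟ᵗ r′))

-- The letters 1 (true) for a left child and 0 (false) for a right child, for
-- all the leaves read from left to right.  The first argument is the side of
-- the tree itself, and is used only if it is a leaf.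
leafSides : Bool → BT → List Bool
leafSides s (leaf _)     = [ s ]
leafSides s (node l _ r) = leafSides true l ++ leafSides false r

-- A tree with n nodes has n + 1 leaves.  For the empty tree the result is the
-- empty word, whatever side is given.
canopy : BT → List Bool
canopy t = drop 1 (take (#nodes t) (leafSides false t))

infixl 6 _/ᵗ_ _∖ᵗ_

_/ᵗ_ : BT → BT → BT
t /ᵗ leaf _     = t
t /ᵗ node l _ r = node (t /ᵗ l) tt r

_∖ᵗ_ : BT → BT → BT
leaf _     ∖ᵗ t = t
node l _ r ∖ᵗ t = node l tt (r ∖ᵗ t)

insert : ℕ → Tree ℕ ⊤ → Tree ℕ ⊤
insert a (leaf _)     = node (leaf tt) a (leaf tt)
insert a (node l b r) =
  if does (a ≤? b) then node (insert a l) b r else node l b (insert a r)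

shape : Tree ℕ ⊤ → BT
shape = mapₙ (const tt)

𝖯 : 𝔖 n → BT × BT
𝖯 σ = shape (foldl (λ t a → insert a t) (leaf tt) (word σ))
    , shape (foldr insert (leaf tt) (word σ))

-- Pairs of twin binary trees with n nodes.  Two pairs are equal as soon as
-- their trees are.
record Twin (n : ℕ) : Set where
  constructor twin
  field
    treeL treeR : BT
    .sizeL      : #nodes treeL ≡ n
    .sizeR      : #nodes treeR ≡ n
    .twins      : Pointwise _≢_ (canopy treeL) (canopy treeR)

open Twin public

trees : Twin n → BT × BT
trees J = treeL J , treeR J

-- All binary trees of height at most h, each of them once.
bounded : ℕ → List BT
bounded zero    = [ leaf tt ]
bounded (suc h) =
  leaf tt ∷ cartesianProductWith (λ l r → node l tt r) (bounded h) (bounded h)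

-- A tree with n nodes has height at most n.
allTwins : ∀ n → List (Twin n)
allTwins n = mapMaybe
  (λ (l , r) → Maybe.map (λ (p , q , c) → twin l r p q c)
       (dec⇒maybe ((#nodes l ≟ n) ×-dec (#nodes r ≟ n)
         ×-dec decidable (λ s t → ¬? (s ≟ᵇ t)) (canopy l) (canopy r))))
  (cartesianProduct (bounded n) (bounded n))
  where open import Data.Bool.Properties using () renaming (_≟_ to _≟ᵇ_)

infix 4 _≤B_ _≤B?_

_≤B_ : Twin n → Twin n → Set
_≤B_ {n} J₀ J₁ = ∃₂ λ (σ ν : 𝔖 n) → σ ≤P ν × 𝖯 σ ≡ trees J₀ × 𝖯 ν ≡ trees J₁

infix 4 _≟²_

_≟²_ : DecidableEquality (BT × BT)
_≟²_ = ×-≡-dec _≟ᵗ_ _≟ᵗ_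

_≤B?_ : (J₀ J₁ : Twin n) → Dec (J₀ ≤B J₁)
_≤B?_ {n} J₀ J₁ = map′
  (λ q → let (σ , ν) , _ , r = find {P = Witnesses} q in σ , ν , r)
  (λ (σ , ν , r) → lose {P = Witnesses} (∈-cartesianProduct⁺ (∈-permutations σ) (∈-permutations ν)) r)
  (any? witnesses? (cartesianProduct (permutations n) (permutations n)))
  where
  Witnesses : 𝔖 n × 𝔖 n → Set
  Witnesses (σ , ν) = σ ≤P ν × 𝖯 σ ≡ trees J₀ × 𝖯 ν ≡ trees J₁
  witnesses? : Decidable₁ Witnesses
  witnesses? (σ , ν) = (σ ≤P? ν) ×-dec (𝖯 σ ≟² trees J₀) ×-dec (𝖯 ν ≟² trees J₁)

-- The operations / and \ preserve twin binary trees: the canopies of S / T and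
-- S \ T are the concatenations of the canopies of S and T, with the letter 0,
-- respectively 1, in between.

leafSides-∖ : ∀ t → ∃ λ w → leafSides false t ≡ w ∷ʳ false ×
              (∀ t′ → leafSides false (t ∖ᵗ t′) ≡ w ++ leafSides false t′)
leafSides-∖ (leaf _)     = [] , refl , λ _ → refl
leafSides-∖ (node l _ r) with leafSides-∖ r
... | w , e , h = leafSides true l ++ w
  , trans (cong (leafSides true l ++_) e) (sym (++-assoc (leafSides true l) w _))
  , λ t′ → trans (cong (leafSides true l ++_) (h t′)) (sym (++-assoc (leafSides true l) w _))

leafSides-/ : ∀ t → ∃ λ w → leafSides true t ≡ true ∷ w ×
              (∀ t′ → leafSides true (t′ /ᵗ t) ≡ leafSides true t′ ++ w)
leafSides-/ (leaf _)     = [] , refl , λ t′ → sym (++-identityʳ _)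
leafSides-/ (node l _ r) with leafSides-/ l
... | w , e , h = w ++ leafSides false r
  , cong (_++ leafSides false r) e
  , λ t′ → trans (cong (_++ leafSides false r) (h t′))
                 (++-assoc (leafSides true t′) w _)

length-leafSides : ∀ s t → length (leafSides s t) ≡ suc (#nodes t)
length-leafSides s (leaf _)     = refl
length-leafSides s (node l _ r) =
  trans (length-++ (leafSides true l))
        (cong₂ _+_ (length-leafSides true l) (length-leafSides false r))

take-∷ʳ : ∀ k (w : List Bool) s → length (w ∷ʳ s) ≡ suc k → take k (w ∷ʳ s) ≡ w
take-∷ʳ zero    []          s e = refl
take-∷ʳ zero    (_ ∷ [])    s ()
take-∷ʳ zero    (_ ∷ _ ∷ _) s ()
take-∷ʳ (suc k) []          s ()
take-∷ʳ (suc k) (a ∷ w)     s e = cong (a ∷_) (take-∷ʳ k w s (suc-injective e))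

canopy-unique : ∀ t w → leafSides false t ≡ (true ∷ w) ∷ʳ false → canopy t ≡ w
canopy-unique t w e = cong (drop 1) (trans (cong (take (#nodes t)) e)
  (take-∷ʳ (#nodes t) (true ∷ w) false
    (trans (cong length (sym e)) (length-leafSides false t))))

leafSides-node : ∀ l r → let t = node l tt r in
                 leafSides false t ≡ (true ∷ canopy t) ∷ʳ false
leafSides-node l r with leafSides-/ l | leafSides-∖ r
... | u , e , _ | v , f , _ =
  trans eq (cong (λ w → (true ∷ w) ∷ʳ false)
    (sym (canopy-unique (node l tt r) (u ++ v) eq)))
  where
  eq : leafSides true l ++ leafSides false r ≡ (true ∷ (u ++ v)) ∷ʳ false
  eq = trans (cong₂ _++_ e f) (cong (true ∷_) (sym (++-assoc u v _)))

∷ʳ-inj : ∀ {u v : List Bool} {s t} → u ∷ʳ s ≡ v ∷ʳ t → u ≡ v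
∷ʳ-inj {u} {v} e = proj₁ (∷ʳ-injective u v e)
  where open import Data.List.Properties using (∷ʳ-injective)

∷-inj : ∀ {u v : List Bool} {s t} → s ∷ u ≡ t ∷ v → u ≡ v
∷-inj refl = refl

canopy-∖ : ∀ l r l′ r′ → let t = node l tt r; t′ = node l′ tt r′ in
           canopy (t ∖ᵗ t′) ≡ canopy t ++ true ∷ canopy t′
canopy-∖ l r l′ r′ with leafSides-∖ (node l tt r)
... | w , e , h = canopy-unique (t ∖ᵗ t′) _ (begin
  leafSides false (t ∖ᵗ t′)                        ≡⟨ h t′ ⟩
  w ++ leafSides false t′                          ≡⟨ cong₂ _++_ w≡ (leafSides-node l′ r′) ⟩
  (true ∷ canopy t) ++ (true ∷ canopy t′) ∷ʳ false ≡⟨ ++-assoc (true ∷ canopy t) _ _ ⟨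
  (true ∷ canopy t ++ true ∷ canopy t′) ∷ʳ false   ∎)
  where
  open ≡-Reasoning
  t  = node l tt r
  t′ = node l′ tt r′
  w≡ : w ≡ true ∷ canopy t
  w≡ = ∷ʳ-inj (trans (sym e) (leafSides-node l r))

canopy-/ : ∀ l r l′ r′ → let t = node l tt r; t′ = node l′ tt r′ in
           canopy (t /ᵗ t′) ≡ canopy t ++ false ∷ canopy t′
canopy-/ l r l′ r′ with leafSides-/ (node l′ tt r′)
... | w , e , h = canopy-unique (t /ᵗ t′) _ (begin
  leafSides false (t /ᵗ t′)                        ≡⟨ h t ⟩
  leafSides true t ++ w                            ≡⟨ cong₂ _++_ (leafSides-node l r) w≡ ⟩
  ((true ∷ canopy t) ∷ʳ false) ++ canopy t′ ∷ʳ false ≡⟨ ++-assoc (true ∷ canopy t) _ _ ⟩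
  (true ∷ canopy t) ++ (false ∷ canopy t′) ∷ʳ false ≡⟨ ++-assoc (true ∷ canopy t) _ _ ⟨
  (true ∷ canopy t ++ false ∷ canopy t′) ∷ʳ false  ∎)
  where
  open ≡-Reasoning
  t  = node l tt r
  t′ = node l′ tt r′
  w≡ : w ≡ canopy t′ ∷ʳ false
  w≡ = ∷-inj (trans (sym e) (leafSides-node l′ r′))

#nodes-/ : ∀ t t′ → #nodes (t /ᵗ t′) ≡ #nodes t + #nodes t′
#nodes-/ t (leaf _)     = sym (+-identityʳ _)
#nodes-/ t (node l _ r) =
  trans (cong (_+ suc (#nodes r)) (#nodes-/ t l)) (+-assoc (#nodes t) _ _)

#nodes-∖ : ∀ t t′ → #nodes (t ∖ᵗ t′) ≡ #nodes t + #nodes t′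
#nodes-∖ (leaf _)     t′ = refl
#nodes-∖ (node l _ r) t′ =
  trans (cong (λ k → #nodes l + suc k) (#nodes-∖ r t′))
        (sym (+-assoc (#nodes l) (suc (#nodes r)) _))

∖-leaf : ∀ t → t ∖ᵗ leaf tt ≡ t
∖-leaf (leaf _)     = refl
∖-leaf (node l _ r) = cong (node l tt) (∖-leaf r)

leaf-/ : ∀ t → leaf tt /ᵗ t ≡ t
leaf-/ (leaf _)     = refl
leaf-/ (node l _ r) = cong (λ l′ → node l′ tt r) (leaf-/ l)

#nodes≢0 : ∀ (l r : BT) → #nodes l + suc (#nodes r) ≢ 0
#nodes≢0 l r e with trans (sym (+-suc (#nodes l) (#nodes r))) e
... | ()

twins-∖/ : ∀ s t s′ t′ → #nodes s ≡ #nodes t → #nodes s′ ≡ #nodes t′ →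
           Pointwise _≢_ (canopy s) (canopy t) →
           Pointwise _≢_ (canopy s′) (canopy t′) →
           Pointwise _≢_ (canopy (s ∖ᵗ s′)) (canopy (t /ᵗ t′)) ×
           Pointwise _≢_ (canopy (s /ᵗ s′)) (canopy (t ∖ᵗ t′))
twins-∖/ (leaf _) (leaf _) s′ t′ _ _ c c′ =
    subst (λ u → Pointwise _≢_ (canopy s′) (canopy u)) (sym (leaf-/ t′)) c′
  , subst (λ u → Pointwise _≢_ (canopy u) (canopy t′)) (sym (leaf-/ s′)) c′
twins-∖/ (leaf _) (node l _ r) _ _ e = contradiction (sym e) (#nodes≢0 l r)
twins-∖/ (node l _ r) (leaf _) _ _ e = contradiction e (#nodes≢0 l r)
twins-∖/ s@(node _ _ _) t@(node _ _ _) (leaf _) (leaf _) _ _ c _ =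
    subst (λ u → Pointwise _≢_ (canopy u) (canopy t)) (sym (∖-leaf s)) c
  , subst (λ u → Pointwise _≢_ (canopy s) (canopy u)) (sym (∖-leaf t)) c
twins-∖/ (node _ _ _) (node _ _ _) (leaf _) (node l _ r) _ e =
  contradiction (sym e) (#nodes≢0 l r)
twins-∖/ (node _ _ _) (node _ _ _) (node l _ r) (leaf _) _ e =
  contradiction e (#nodes≢0 l r)
twins-∖/ (node l₁ _ r₁) (node l₂ _ r₂) (node l₃ _ r₃) (node l₄ _ r₄) _ _ c c′ =
    subst₂ (Pointwise _≢_) (sym (canopy-∖ l₁ r₁ l₃ r₃)) (sym (canopy-/ l₂ r₂ l₄ r₄))
      (pointwise-++⁺ c ((λ ()) ∷ c′))
  , subst₂ (Pointwise _≢_) (sym (canopy-/ l₁ r₁ l₃ r₃)) (sym (canopy-∖ l₂ r₂ l₄ r₄))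
      (pointwise-++⁺ c ((λ ()) ∷ c′))

infixl 6 _/_ _∖_

_/_ : Twin m → Twin n → Twin (m + n)
twin s t p q c / twin s′ t′ p′ q′ c′ = twin (s ∖ᵗ s′) (t /ᵗ t′)
  (trans (#nodes-∖ s s′) (cong₂ _+_ p p′))
  (trans (#nodes-/ t t′) (cong₂ _+_ q q′))
  (proj₁ (twins-∖/ s t s′ t′ (trans p (sym q)) (trans p′ (sym q′)) c c′))

_∖_ : Twin m → Twin n → Twin (m + n)
twin s t p q c ∖ twin s′ t′ p′ q′ c′ = twin (s /ᵗ s′) (t ∖ᵗ t′)
  (trans (#nodes-/ s s′) (cong₂ _+_ p p′))
  (trans (#nodes-∖ t t′) (cong₂ _+_ q q′))
  (proj₂ (twins-∖/ s t s′ t′ (trans p (sym q)) (trans p′ (sym q′)) c c′))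

-- Every interleaving occurs once.
shuffles : ∀ {A : Set} (v w : List A) → List (∃ (Interleaving v w))
shuffles []      []      = [ [] , [] ]
shuffles []      (b ∷ w) = map (λ (u , i) → b ∷ u , consʳ i) (shuffles [] w)
shuffles (a ∷ v) []      = map (λ (u , i) → a ∷ u , consˡ i) (shuffles v [])
shuffles (a ∷ v) (b ∷ w) =
     map (λ (u , i) → a ∷ u , consˡ i) (shuffles v (b ∷ w))
  ++ map (λ (u , i) → b ∷ u , consʳ i) (shuffles (a ∷ v) w)

shiftedShuffles : 𝔖 m → 𝔖 n → List (𝔖 (m + n))
shiftedShuffles {m} {n} (perm v p) (perm w q) =
  map (λ (u , i) → perm u (↭-trans (toPermutation i)
         (↭-trans (++⁺ p (map⁺ (m +_) q)) (↭-reflexive (sym (range-+ m n))))))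
      (shuffles v (map (m +_) w))

module _ {c ℓ₁ ℓ₂} (𝕂 : HeytingField c ℓ₁ ℓ₂) where

  open HeytingField 𝕂 using (_≈_; 0#; 1#) renaming (_+_ to _⊹_)

  fromℕ : ℕ → HeytingField.Carrier 𝕂
  fromℕ zero    = 0#
  fromℕ (suc n) = 1# ⊹ fromℕ n

  CharacteristicZero : Set ℓ₁
  CharacteristicZero = ∀ n → ¬ (fromℕ (suc n) ≈ 0#)

module OverField {c ℓ₁ ℓ₂} (𝕂 : HeytingField c ℓ₁ ℓ₂) where

  open HeytingField 𝕂 using (Carrier; _≈_; 0#; 1#; _*_) renaming (_+_ to _⊹_)

  -- Formal linear combinations of permutations, identified by _≋_ when all
  -- the coefficients agree.
  FQSym : Set c
  FQSym = List (Carrier × ∃ 𝔖)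

  coeff : FQSym → 𝔖 n → Carrier
  coeff x σ = foldr
    (λ (a , _ , ν) s → if does (word ν ≟ʷ word σ) then a ⊹ s else s) 0# x

  infix 4 _≋_

  _≋_ : FQSym → FQSym → Set ℓ₁
  x ≋ y = ∀ {n} (σ : 𝔖 n) → coeff x σ ≈ coeff y σ

  infixr 7 _⊙_
  infixl 7 _·_

  _⊙_ : Carrier → FQSym → FQSym
  a ⊙ x = map (λ (b , σ) → a * b , σ) x

  ∑ : ∀ {A : Set} → List A → (A → FQSym) → FQSym
  ∑ is f = concatMap f is

  𝐅 : 𝔖 n → FQSym
  𝐅 σ = [ 1# , _ , σ ]

  _·_ : FQSym → FQSym → FQSym
  x · y = concatMap (λ (a , _ , σ) →
            concatMap (λ (b , _ , ν) →
              (a * b) ⊙ ∑ (shiftedShuffles σ ν) 𝐅) y) x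

  -- Elements of Baxter are regarded as elements of FQSym.
  𝐏 : Twin n → FQSym
  𝐏 {n} J = ∑ (filter (λ σ → 𝖯 σ ≟² trees J) (permutations n)) 𝐅

  𝐄 : Twin n → FQSym
  𝐄 {n} J = ∑ (filter (λ J′ → J ≤B? J′) (allTwins n)) 𝐏

  𝐇 : Twin n → FQSym
  𝐇 {n} J = ∑ (filter (λ J′ → J′ ≤B? J) (allTwins n)) 𝐏

{-# OPTIONS --safe #-}

-- Expanding, 𝐄 J is the sum of the 𝐅 π with J ≤B P(π), so the first equality
-- says that J₀ / J₁ ≤B P(π) if and only if J₀ ≤B P(π₁) and J₁ ≤B P(π₂), where
-- π₁ and π₂ are the subwords of the letters ≤ m and > m of π ∈ 𝔖 (m + n).
-- For the direct implication, restrict σ ≤P ν with P(σ) = J₀ / J₁ and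
-- P(ν) = P(π) to small and to large letters: restriction commutes with binary
-- search tree insertion, hence is defined on P-symbols.
-- For the converse, let α ≤P σ, α′ ≤P σ′ with P(α) = J₀, P(σ) = P(π₁),
-- P(α′) = J₁, P(σ′) = P(π₂).  Two permutations have the same P-symbol if and
-- only if they are connected by exchanges of adjacent letters x, y such that
-- letters strictly between x and y occur both before and after them.  Such
-- exchanges in π₁ and π₂ lift to π, which gives a shuffle π′ of σ and σ′[m]
-- with P(π′) = P(π).  It lies above α·α′[m], whose P-symbol is J₀ / J₁.
-- The second equality is dual, with the concatenation α′[m]·α.

module Submission where

open import Defs
open import Algebra.Apartness.Bundles using (HeytingField)
open import Data.Bool.Base using (Bool; true; false; if_then_else_)
import Data.Bool.Properties as Bool
open import Data.List.Base hiding (find)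
open import Data.List.Membership.Propositional using (_∈_; _∉_; find; lose)
open import Data.List.Membership.Propositional.Properties
open import Data.List.Properties
open import Data.List.Relation.Binary.Permutation.Propositional using
  (_↭_; prep; swap; ↭-refl; ↭-sym; ↭-trans; ↭-reflexive; ↭⇒↭ₛ)
open import Data.List.Relation.Binary.Permutation.Propositional.Properties using
  ( ∈-resp-↭; All-resp-↭; ↭-reverse; ↭-empty-inv; drop-∷; shift
  ; ++⁺; ++⁺ˡ; ++⁺ʳ; ++-comm; filter-↭; map⁺ )
import Data.List.Relation.Binary.Permutation.Setoid.Properties as ↭ₛ
open import Data.List.Relation.Binary.Pointwise as Pointwise using (Pointwise; []; _∷_)
import Data.List.Relation.Ternary.Interleaving.Properties as Interleaving
open import Data.List.Relation.Ternary.Interleaving.Propositional as Interleaving using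
  (Interleaving; []; consˡ; consʳ; toPermutation)
open import Data.List.Relation.Unary.All as All using (All; []; _∷_)
import Data.List.Relation.Unary.All.Properties as All
open import Data.List.Relation.Unary.AllPairs as AllPairs using (AllPairs; []; _∷_)
import Data.List.Relation.Unary.AllPairs.Properties as AllPairs
open import Data.List.Relation.Unary.Any using (Any; here; there; any?)
import Data.List.Relation.Unary.Any.Properties as Any
open import Data.List.Relation.Unary.Unique.Propositional using (Unique)
import Data.List.Relation.Unary.Unique.Propositional.Properties as Unique
open import Data.Maybe.Base as Maybe using (Maybe; just; nothing)
open import Data.Nat.Base hiding (_/_)
open import Data.Nat.Properties
open import Data.Product.Base using (∃; ∃₂; _×_; _,_; proj₁; proj₂)
open import Data.Sum.Base using (_⊎_; inj₁; inj₂)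
open import Data.Tree.Binary using (Tree; leaf; node; #nodes; mapₙ)
open import Data.Tree.Binary.Properties using (#nodes-mapₙ)
open import Data.Unit.Base using (⊤; tt)
open import Function.Base using (_∘_; const; flip; id)
open import Level using (Level)
open import Relation.Binary.Construct.Closure.ReflexiveTransitive as Star using
  (Star; ε; _◅_; _◅◅_)
open import Relation.Binary.PropositionalEquality hiding ([_])
open import Relation.Nullary.Decidable using
  (Dec; does; yes; no; dec-true; dec-false; dec⇒maybe; recompute; _×-dec_; ¬?)
open import Relation.Nullary.Negation using (¬_; contradiction)
open import Relation.Unary using (Decidable)

-- Binary search trees and the exchanges that preserve them

-- The obstacle is that `_≤B_` compares chosen representatives: σ has the P-symbol of π₁ without
-- being π₁, and putting it in the positions of the small letters of π need not keep P(π). For m =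
-- 4, π = 24513 and π₁ = 2413, the word 2143 is equivalent to π₁, but 21543 is not equivalent to π.
-- Exchanges are therefore lifted one at a time. Large letters standing between small letters x < y
-- are first passed by x, with the same witnesses: whatever lies strictly between x and y lies
-- strictly between x and any large letter. Witnesses come from the node at which the search paths
-- of two letters separate: two insertions commute once such a node is present, and two words with
-- equal trees have it in common. `_≈ᴮ_` compares labelled trees although P-symbols are shapes; for
-- permutations this is the same, the labels of a search tree being sorted from left to right.
-- Expanding 𝐄 J over permutations requires that every P-symbol is a pair of twin trees, hence an
-- index of the sum, and that no permutation is repeated. All coefficients are then 0 or 1, and only
-- supports have to be compared.

LTree : Set
LTree = Tree ℕ ⊤

insert-≤ : ∀ {a b} l r → a ≤ b → insert a (node l b r) ≡ node (insert a l) b r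
insert-≤ {a} {b} l r a≤b rewrite dec-true (a ≤? b) a≤b = refl

insert-> : ∀ {a b} l r → b < a → insert a (node l b r) ≡ node l b (insert a r)
insert-> {a} {b} l r b<a rewrite dec-false (a ≤? b) (<⇒≱ b<a) = refl

bst : List ℕ → LTree
bst = foldr insert (leaf tt)

-- Meet a d t x: the node x is where the searches for a and for d in t
-- separate or end, and it lies in the interval [a , d].
data Meet (a d : ℕ) : LTree → ℕ → Set where
  here  : ∀ {l b r} → a ≤ b → b ≤ d → Meet a d (node l b r) b
  left  : ∀ {l b r x} → d < b → Meet a d l x → Meet a d (node l b r) x
  right : ∀ {l b r x} → b < a → Meet a d r x → Meet a d (node l b r) x

module _ {a d : ℕ} where

  -- In particular a ≤ d, which is assumed nowhere; this excludes a root b with d < b < a.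
  Meet-bounds : ∀ {t x} → Meet a d t x → a ≤ x × x ≤ d
  Meet-bounds (here p q)  = p , q
  Meet-bounds (left _ m)  = Meet-bounds m
  Meet-bounds (right _ m) = Meet-bounds m

  Meet-unique : ∀ {t x y} → Meet a d t x → Meet a d t y → x ≡ y
  Meet-unique (here _ _)  (here _ _)  = refl
  Meet-unique (here _ q)  (left q′ _) = contradiction q (<⇒≱ q′)
  Meet-unique (here p _)  (right p′ _) = contradiction p (<⇒≱ p′)
  Meet-unique (left q _)  (here _ q′) = contradiction q′ (<⇒≱ q)
  Meet-unique (left _ m)  (left _ m′) = Meet-unique m m′
  Meet-unique {y = y} (left q m)  (right p m′) =
    contradiction (≤-trans (proj₁ (Meet-bounds m)) (proj₂ (Meet-bounds m))) (<⇒≱ (<-trans q p))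
  Meet-unique (right p _) (here p′ _) = contradiction p′ (<⇒≱ p)
  Meet-unique (right p m) (left q m′) =
    contradiction (≤-trans (proj₁ (Meet-bounds m)) (proj₂ (Meet-bounds m))) (<⇒≱ (<-trans q p))
  Meet-unique (right _ m) (right _ m′) = Meet-unique m m′

  Meet-insert : ∀ z {t x} → Meet a d t x → Meet a d (insert z t) x
  Meet-insert z {node l b r} m with ≤-<-connex z b
  Meet-insert z {node l b r} m | inj₁ z≤b rewrite insert-≤ l r z≤b with m
  ... | here p q  = here p q
  ... | left p m′ = left p (Meet-insert z m′)
  ... | right p m′ = right p m′
  Meet-insert z {node l b r} m | inj₂ z>b rewrite insert-> l r z>b with m
  ... | here p q  = here p q
  ... | left p m′ = left p m′
  ... | right p m′ = right p (Meet-insert z m′)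

  Meet-insert⁻ : ∀ z t {x} → Meet a d (insert z t) x → x ≡ z ⊎ Meet a d t x
  Meet-insert⁻ z (leaf _) (here _ _) = inj₁ refl
  Meet-insert⁻ z (node l b r) m with ≤-<-connex z b
  Meet-insert⁻ z (node l b r) m | inj₁ z≤b rewrite insert-≤ l r z≤b with m
  ... | here p q   = inj₂ (here p q)
  ... | right p m′ = inj₂ (right p m′)
  ... | left p m′ with Meet-insert⁻ z l m′
  ...   | inj₁ e  = inj₁ e
  ...   | inj₂ m″ = inj₂ (left p m″)
  Meet-insert⁻ z (node l b r) m | inj₂ z>b rewrite insert-> l r z>b with m
  ... | here p q   = inj₂ (here p q)
  ... | left p m′  = inj₂ (left p m′)
  ... | right p m′ with Meet-insert⁻ z r m′
  ...   | inj₁ e  = inj₁ e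
  ...   | inj₂ m″ = inj₂ (right p m″)

  -- A letter of [a , d] follows the paths of a and d as long as these agree. Either it reaches a
  -- leaf with both and becomes the meeting node, or they have met before.
  Meet-fresh : ∀ {z} t → a ≤ z → z ≤ d → Meet a d (insert z t) z ⊎ ∃ (Meet a d t)
  Meet-fresh (leaf _) p q = inj₁ (here p q)
  Meet-fresh {z} (node l b r) p q with ≤-<-connex z b | ≤-<-connex b d | ≤-<-connex a b
  ... | _ | inj₁ b≤d | inj₁ a≤b = inj₂ (_ , here a≤b b≤d)
  ... | inj₁ z≤b | _ | inj₂ b<a = contradiction (≤-trans p z≤b) (<⇒≱ b<a)
  ... | inj₂ b<z | inj₂ d<b | _ = contradiction q (<⇒≱ (<-trans d<b b<z))
  ... | inj₁ z≤b | inj₂ d<b | inj₁ _ rewrite insert-≤ l r z≤b with Meet-fresh l p q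
  ...   | inj₁ m       = inj₁ (left d<b m)
  ...   | inj₂ (_ , m) = inj₂ (_ , left d<b m)
  Meet-fresh {z} (node l b r) p q | inj₂ b<z | inj₁ _ | inj₂ b<a
    rewrite insert-> l r b<z with Meet-fresh r p q
  ...   | inj₁ m       = inj₁ (right b<a m)
  ...   | inj₂ (_ , m) = inj₂ (_ , right b<a m)

  Meet-bst : ∀ {c w} → c ∈ w → a ≤ c → c ≤ d → ∃ (Meet a d (bst w))
  Meet-bst {w = b ∷ w} (here refl) p q with Meet-fresh (bst w) p q
  ... | inj₁ m       = _ , m
  ... | inj₂ (_ , m) = _ , Meet-insert b m
  Meet-bst {w = b ∷ w} (there c∈) p q with Meet-bst c∈ p q
  ... | _ , m = _ , Meet-insert b m

  Meet-bst⁻ : ∀ w {x} → Meet a d (bst w) x → x ∈ w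
  Meet-bst⁻ (b ∷ w) m with Meet-insert⁻ b (bst w) m
  ... | inj₁ refl = here refl
  ... | inj₂ m′   = there (Meet-bst⁻ w m′)

  -- `bst` inserts from right to left, so the letters of s come last and only add nodes below the
  -- existing ones.
  Meet-bst-++ : ∀ s {w x} → Meet a d (bst w) x → Meet a d (bst (s ++ w)) x
  Meet-bst-++ []      m = m
  Meet-bst-++ (b ∷ s) m = Meet-insert b (Meet-bst-++ s m)

-- A search goes left on equality, so the paths of a and of `suc e` separate exactly at a label in
-- [a , e], after which the insertions act on different subtrees. Hence the upper end e, one less
-- than the inserted letter.
insert-comm : ∀ {a e t x} → Meet a e t x →
              insert a (insert (suc e) t) ≡ insert (suc e) (insert a t)
insert-comm {a} {e} (here {l} {b} {r} a≤b b≤e)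
  rewrite insert-> l r (s≤s b≤e) | insert-≤ l r a≤b
        | insert-≤ l (insert (suc e) r) a≤b | insert-> (insert a l) r (s≤s b≤e) = refl
insert-comm {a} {e} (left {l} {b} {r} e<b m)
  with a≤b ← <⇒≤ (≤-<-trans (≤-trans (proj₁ (Meet-bounds m)) (proj₂ (Meet-bounds m))) e<b)
  rewrite insert-≤ l r e<b | insert-≤ l r a≤b
        | insert-≤ (insert (suc e) l) r a≤b | insert-≤ (insert a l) r e<b
  = cong (λ l → node l b r) (insert-comm m)
insert-comm {a} {e} (right {l} {b} {r} b<a m)
  with b<e ← m≤n⇒m≤1+n (<-≤-trans b<a (≤-trans (proj₁ (Meet-bounds m)) (proj₂ (Meet-bounds m))))
  rewrite insert-> l r b<a | insert-> l r b<e
        | insert-> l (insert (suc e) r) b<a | insert-> l (insert a r) b<e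
  = cong (node l b) (insert-comm m)

Between : ℕ → ℕ → ℕ → Set
Between x y c = (x < c × c < y) ⊎ (y < c × c < x)

Between-sym : ∀ {x y c} → Between x y c → Between y x c
Between-sym (inj₁ p) = inj₂ p
Between-sym (inj₂ p) = inj₁ p

insert-comm-bst : ∀ {x y c} v → c ∈ v → Between x y c →
                  insert x (insert y (bst v)) ≡ insert y (insert x (bst v))
insert-comm-bst {x} {suc e} v c∈v (inj₁ (x<c , s≤s c≤e)) =
  insert-comm (proj₂ (Meet-bst c∈v (<⇒≤ x<c) c≤e))
insert-comm-bst {suc e} {y} v c∈v (inj₂ (y<c , s≤s c≤e)) =
  sym (insert-comm (proj₂ (Meet-bst c∈v (<⇒≤ y<c) c≤e)))

infix 4 _⇝_ _⇝*_ _≈ᴮ_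

-- On permutations this generates the Baxter congruence. The witness c serves the right-to-left
-- insertion, the witness b the left-to-right one. The order of x and y is left open, which makes
-- the relation symmetric.
data _⇝_ : List ℕ → List ℕ → Set where
  move : ∀ u {x y} v {b c} → b ∈ u → Between x y b → c ∈ v → Between x y c →
         (u ++ x ∷ y ∷ v) ⇝ (u ++ y ∷ x ∷ v)

_⇝*_ : List ℕ → List ℕ → Set
_⇝*_ = Star _⇝_

⇝-sym : ∀ {w w′} → w ⇝ w′ → w′ ⇝ w
⇝-sym (move u v b∈u p c∈v q) = move u v b∈u (Between-sym p) c∈v (Between-sym q)

reverse-mid : ∀ u (x : ℕ) v → reverse (u ++ x ∷ v) ≡ reverse v ++ x ∷ reverse u
reverse-mid u x v = begin
  reverse (u ++ x ∷ v)              ≡⟨ reverse-++ u (x ∷ v) ⟩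
  reverse (x ∷ v) ++ reverse u      ≡⟨ cong (_++ reverse u) (unfold-reverse x v) ⟩
  (reverse v ∷ʳ x) ++ reverse u     ≡⟨ ++-assoc (reverse v) _ _ ⟩
  reverse v ++ x ∷ reverse u        ∎
  where open ≡-Reasoning

reverse-mid₂ : ∀ u (x y : ℕ) v → reverse (u ++ x ∷ y ∷ v) ≡ reverse v ++ y ∷ x ∷ reverse u
reverse-mid₂ u x y v = begin
  reverse (u ++ x ∷ y ∷ v)            ≡⟨ reverse-mid u x (y ∷ v) ⟩
  reverse (y ∷ v) ++ x ∷ reverse u    ≡⟨ cong (_++ x ∷ reverse u) (unfold-reverse y v) ⟩
  (reverse v ∷ʳ y) ++ x ∷ reverse u   ≡⟨ ++-assoc (reverse v) _ _ ⟩
  reverse v ++ y ∷ x ∷ reverse u      ∎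
  where open ≡-Reasoning

⇝-reverse : ∀ {w w′} → w ⇝ w′ → reverse w ⇝ reverse w′
⇝-reverse (move u {x} {y} v b∈u p c∈v q) =
  subst₂ _⇝_ (sym (reverse-mid₂ u x y v)) (sym (reverse-mid₂ u y x v))
    (move (reverse v) (reverse u) (Any.reverse⁺ c∈v) (Between-sym q)
      (Any.reverse⁺ b∈u) (Between-sym p))

⇝-bst : ∀ {w w′} → w ⇝ w′ → bst w ≡ bst w′
⇝-bst (move u {x} {y} v _ _ c∈v q) = begin
  bst (u ++ x ∷ y ∷ v)                    ≡⟨ foldr-++ insert (leaf tt) u _ ⟩
  foldr insert (bst (x ∷ y ∷ v)) u        ≡⟨ cong (λ t → foldr insert t u) (insert-comm-bst v c∈v q) ⟩
  foldr insert (bst (y ∷ x ∷ v)) u        ≡⟨ foldr-++ insert (leaf tt) u _ ⟨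
  bst (u ++ y ∷ x ∷ v)                    ∎
  where open ≡-Reasoning

-- The labels are kept because restriction to small or large letters is an operation on labelled
-- trees.
record _≈ᴮ_ (w w′ : List ℕ) : Set where
  constructor _,_
  field
    bstL : bst (reverse w) ≡ bst (reverse w′)
    bstR : bst w ≡ bst w′

≈ᴮ-trans : ∀ {u v w} → u ≈ᴮ v → v ≈ᴮ w → u ≈ᴮ w
≈ᴮ-trans (p , q) (p′ , q′) = trans p p′ , trans q q′

≈ᴮ-sym : ∀ {u v} → u ≈ᴮ v → v ≈ᴮ u
≈ᴮ-sym (p , q) = sym p , sym q

⇝*⇒≈ᴮ : ∀ {w w′} → w ⇝* w′ → w ≈ᴮ w′
⇝*⇒≈ᴮ ε        = refl , refl
⇝*⇒≈ᴮ (m ◅ ms) = ≈ᴮ-trans (⇝-bst (⇝-reverse m) , ⇝-bst m) (⇝*⇒≈ᴮ ms)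

⊓≤⊔ : ∀ {x y c} → x ⊓ y ≤ c → c ≤ x ⊔ y → c ≢ x → c ≢ y → Between x y c
⊓≤⊔ {x} {y} {c} p q c≢x c≢y with ≤-total x y
... | inj₁ x≤y rewrite m≤n⇒m⊓n≡m x≤y | m≤n⇒m⊔n≡n x≤y = inj₁ (≤∧≢⇒< p (≢-sym c≢x) , ≤∧≢⇒< q c≢y)
... | inj₂ y≤x rewrite m≥n⇒m⊓n≡n y≤x | m≥n⇒m⊔n≡m y≤x = inj₂ (≤∧≢⇒< p (≢-sym c≢y) , ≤∧≢⇒< q c≢x)

-- The searches for x and y separate at the last letter of the word that lies
-- between x and y inclusive.  By q′ this letter is not x, so it occurs in q.
∃-between : ∀ {x y} s q s′ q′ → bst (s ++ x ∷ q) ≡ bst (s′ ++ q′) → x ∉ q′ → y ∈ q′ →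
            x ∉ q → y ∉ q → ∃ λ c → c ∈ q × c ∈ q′ × Between x y c
∃-between {x} {y} s q s′ q′ eq x∉q′ y∈q′ x∉q y∉q
  with Meet-fresh (bst q) (m⊓n≤m x y) (m≤m⊔n x y) | Meet-bst y∈q′ (m⊓n≤n x y) (m≤n⊔m x y)
... | inj₁ m | z , m′ = contradiction
  (subst (_∈ q′) (Meet-unique (Meet-bst-++ s′ m′) (subst (λ t → Meet _ _ t x) eq (Meet-bst-++ s m)))
    (Meet-bst⁻ q′ m′)) x∉q′
... | inj₂ (c , m) | z , m′ =
  c , c∈q , subst (_∈ q′) z≡c (Meet-bst⁻ q′ m′)
  , ⊓≤⊔ (proj₁ (Meet-bounds m)) (proj₂ (Meet-bounds m)) (λ { refl → x∉q c∈q }) (λ { refl → y∉q c∈q })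
  where
  c∈q : c ∈ q
  c∈q = Meet-bst⁻ q m
  z≡c : z ≡ c
  z≡c = Meet-unique (Meet-bst-++ s′ m′)
    (subst (λ t → Meet _ _ t c) eq (Meet-bst-++ s (Meet-insert x m)))

-- Words with the same P-symbol are connected by exchanges

Unique-resp-↭ : ∀ {v w : List ℕ} → v ↭ w → Unique v → Unique w
Unique-resp-↭ p = ↭ₛ.Unique-resp-↭ (setoid ℕ) (↭⇒↭ₛ p)

Unique-mid : ∀ s {x : ℕ} {q} → Unique (s ++ x ∷ q) → x ∉ s × x ∉ q
Unique-mid s {x} {q} u with Unique-resp-↭ (shift x s q) u
... | x∉ ∷ _ = (λ x∈ → All.lookup x∉ (∈-++⁺ˡ x∈) refl) , (λ x∈ → All.lookup x∉ (∈-++⁺ʳ s x∈) refl)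

∈-reverse⁻ : ∀ {x : ℕ} w → x ∈ reverse w → x ∈ w
∈-reverse⁻ w = ∈-resp-↭ (↭-reverse w)

-- The witnesses lie in u and q, outside the block being crossed, so no step of the move invalidates
-- them.
bubble : ∀ u p {x} q → (∀ {y} → y ∈ p → ∃ λ b → b ∈ u × Between y x b) →
         (∀ {y} → y ∈ p → ∃ λ c → c ∈ q × Between y x c) →
         (u ++ p ++ x ∷ q) ⇝* (u ++ x ∷ p ++ q)
bubble u []      q _ _ = ε
bubble u (y ∷ p) {x} q B C =
  subst₂ _⇝*_ (++-assoc u _ _) (++-assoc u _ _)
    (bubble (u ++ [ y ]) p q (λ y∈ → let b , b∈ , h = B (there y∈) in b , ∈-++⁺ˡ b∈ , h) (C ∘ there))
  ◅◅ move u (p ++ q) (proj₁ (proj₂ (B (here refl)))) (proj₂ (proj₂ (B (here refl))))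
       (∈-++⁺ʳ p (proj₁ (proj₂ (C (here refl))))) (proj₂ (proj₂ (C (here refl)))) ◅ ε

-- Induction along the target: u is the common prefix already reached, and the next letter x of the
-- target is moved to the front of the rest. A letter y that it passes precedes x in one word and
-- follows it in the other, so the right-to-left trees yield a letter between them after x, and the
-- left-to-right trees one in u. Exchanges preserve both trees, so the hypothesis survives.
≈ᴮ⇒⇝* : ∀ u w w′ → Unique (u ++ w′) → w ↭ w′ → (u ++ w) ≈ᴮ (u ++ w′) → (u ++ w) ⇝* (u ++ w′)
≈ᴮ⇒⇝* u w [] _ w↭ _ rewrite ↭-empty-inv w↭ = ε
≈ᴮ⇒⇝* u w (x ∷ w′) uniq w↭ (eL , eR) with ∈-∃++ (∈-resp-↭ (↭-sym w↭) (here refl))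
... | p , q , refl =
  moves ◅◅ subst₂ _⇝*_ (++-assoc u _ _) (++-assoc u _ _)
    (≈ᴮ⇒⇝* (u ++ [ x ]) (p ++ q) w′ (subst Unique (sym (++-assoc u _ _)) uniq) p++q↭w′
      (subst₂ _≈ᴮ_ (sym (++-assoc u _ _)) (sym (++-assoc u _ _))
        (≈ᴮ-trans (≈ᴮ-sym (⇝*⇒≈ᴮ moves)) (eL , eR))))
  where
  p++q↭w′ : p ++ q ↭ w′
  p++q↭w′ = drop-∷ (↭-trans (↭-sym (shift x p q)) w↭)
  x∉w′ : x ∉ w′
  x∉w′ = proj₂ (Unique-mid u uniq)
  uniq′ : Unique (u ++ p ++ x ∷ q)
  uniq′ = Unique-resp-↭ (++⁺ˡ u (↭-sym w↭)) uniq
  betweens : ∀ {y} → y ∈ p → (∃ λ b → b ∈ u × Between y x b) × (∃ λ c → c ∈ q × Between y x c)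
  betweens {y} y∈p with ∈-∃++ y∈p
  ... | p₀ , p₁ , refl = before , after
    where
    eq₁ : u ++ (p₀ ++ y ∷ p₁) ++ x ∷ q ≡ (u ++ p₀) ++ y ∷ p₁ ++ x ∷ q
    eq₁ = trans (cong (u ++_) (++-assoc p₀ _ _)) (sym (++-assoc u p₀ _))
    eq₂ : u ++ (p₀ ++ y ∷ p₁) ++ x ∷ q ≡ (u ++ p₀ ++ y ∷ p₁) ++ x ∷ q
    eq₂ = sym (++-assoc u _ _)
    y∉ : y ∉ u ++ p₀ × y ∉ p₁ ++ x ∷ q
    y∉ = Unique-mid (u ++ p₀) (subst Unique eq₁ uniq′)
    x∉ : x ∉ u ++ p₀ ++ y ∷ p₁ × x ∉ q
    x∉ = Unique-mid (u ++ p₀ ++ y ∷ p₁) (subst Unique eq₂ uniq′)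
    y≢x : y ≢ x
    y≢x refl = proj₂ y∉ (∈-++⁺ʳ p₁ (here refl))
    y∈w′ : y ∈ w′
    y∈w′ = ∈-resp-↭ p++q↭w′ (∈-++⁺ˡ y∈p)
    after : ∃ λ c → c ∈ q × Between y x c
    after with ∃-between (u ++ p₀ ++ y ∷ p₁) q (u ++ [ x ]) w′
                 (trans (cong bst (sym eq₂)) (trans eR (cong bst (sym (++-assoc u _ _)))))
                 x∉w′ y∈w′ (proj₂ x∉) (proj₂ y∉ ∘ ∈-++⁺ʳ p₁ ∘ there)
    ... | c , c∈q , _ , h = c , c∈q , Between-sym h
    before : ∃ λ b → b ∈ u × Between y x b
    -- Reversal exchanges the roles of x and y. Membership in both suffixes matters here: the suffix
    -- of the first word alone would only place the witness in `u ++ p₀`.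
    before with ∃-between (reverse (p₁ ++ x ∷ q)) (reverse (u ++ p₀)) (reverse w′) (x ∷ reverse u)
                  (trans (cong bst (sym (trans (cong reverse eq₁) (reverse-mid (u ++ p₀) y _))))
                    (trans eL (cong bst (reverse-mid u x w′))))
                  (λ { (here y≡x) → y≢x y≡x ; (there y∈) → proj₁ y∉ (∈-++⁺ˡ (∈-reverse⁻ u y∈)) })
                  (here refl)
                  (proj₁ y∉ ∘ ∈-reverse⁻ (u ++ p₀))
                  (λ x∈ → proj₁ x∉ (subst (x ∈_) (++-assoc u p₀ _) (∈-++⁺ˡ (∈-reverse⁻ (u ++ p₀) x∈))))
    ... | _ , c∈ , here refl , h = contradiction
            (subst (x ∈_) (++-assoc u p₀ _) (∈-++⁺ˡ (∈-reverse⁻ (u ++ p₀) c∈))) (proj₁ x∉)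
    ... | c , _ , there c∈u , h = c , ∈-reverse⁻ u c∈u , h
  moves : (u ++ p ++ x ∷ q) ⇝* (u ++ x ∷ p ++ q)
  moves = bubble u p q (proj₁ ∘ betweens) (proj₂ ∘ betweens)

-- Lifting exchanges to shuffles

-- In contrast to `bubble`, a single pair of witnesses serves the whole block g.
cross : ∀ u x g v {b c} → b ∈ u → c ∈ v →
        (∀ {y} → y ∈ g → Between x y b) → (∀ {y} → y ∈ g → Between x y c) →
        (u ++ x ∷ g ++ v) ⇝* (u ++ g ++ x ∷ v)
cross u x []      v b∈ c∈ B C = ε
cross u x (y ∷ g) v b∈ c∈ B C =
  move u (g ++ v) b∈ (B (here refl)) (∈-++⁺ʳ g c∈) (C (here refl))
  ◅ subst₂ _⇝*_ (++-assoc u _ _) (++-assoc u _ _)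
      (cross (u ++ [ y ]) x g v (∈-++⁺ˡ b∈) c∈ (B ∘ there) (C ∘ there))

-- The cut is made right after the last letter of u: letters of h standing between u and w go with
-- w.
split-++ : ∀ u {w h π : List ℕ} → Interleaving (u ++ w) h π →
  ∃₂ λ u′ w′ → ∃₂ λ h₁ h₂ → h ≡ h₁ ++ h₂ × π ≡ u′ ++ w′ × Interleaving u h₁ u′ × Interleaving w h₂ w′
split-++ []      {h = h} {π} i = [] , π , [] , h , refl , refl , [] , i
split-++ (x ∷ u) (consˡ i) with split-++ u i
... | u′ , w′ , h₁ , h₂ , refl , refl , j , k = x ∷ u′ , w′ , h₁ , h₂ , refl , refl , consˡ j , k
split-++ (x ∷ u) (consʳ i) with split-++ (x ∷ u) i
... | u′ , w′ , h₁ , h₂ , refl , refl , j , k = _ ∷ u′ , w′ , _ ∷ h₁ , h₂ , refl , refl , consʳ j , k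

split-∷ : ∀ {x} {w h π : List ℕ} → Interleaving (x ∷ w) h π →
  ∃₂ λ g w′ → ∃ λ h′ → h ≡ g ++ h′ × π ≡ g ++ x ∷ w′ × Interleaving w h′ w′
split-∷ (consˡ i) = [] , _ , _ , refl , refl , i
split-∷ (consʳ i) with split-∷ i
... | g , w′ , h′ , refl , refl , j = _ ∷ g , w′ , h′ , refl , refl , j

right-only : ∀ (w : List ℕ) → Interleaving [] w w
right-only []      = []
right-only (x ∷ w) = consʳ (right-only w)

-- Witnesses for the exchange of x and y then also let x pass every letter of h.
Crosses : ℕ → ℕ → List ℕ → Set
Crosses x y h = ∀ {g b} → g ∈ h → Between x y b → Between x g b

Separated : List ℕ → List ℕ → Set
Separated v h = ∀ {x y} → x ∈ v → y ∈ v → Crosses x y h ⊎ Crosses y x h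

-- The block g ends up entirely before or entirely after the exchanged pair, according to which of
-- the two letters crosses it; `g₁` and `g₂` treat both outcomes at once.
swap-across : ∀ u {x y} g v {b c} → b ∈ u → Between x y b → c ∈ v → Between x y c →
              Crosses x y g ⊎ Crosses y x g →
              ∃₂ λ g₁ g₂ → g ≡ g₁ ++ g₂ × (u ++ x ∷ g ++ y ∷ v) ⇝* (u ++ g₁ ++ y ∷ x ∷ g₂ ++ v)
swap-across u {x} {y} g v b∈ p c∈ q (inj₁ x-crosses) = g , [] , sym (++-identityʳ g)
  , (cross u x g (y ∷ v) b∈ (there c∈) (λ z∈ → x-crosses z∈ p) (λ z∈ → x-crosses z∈ q)
     ◅◅ subst₂ _⇝*_ (++-assoc u g _) (++-assoc u g _) (move (u ++ g) v (∈-++⁺ˡ b∈) p c∈ q ◅ ε))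
swap-across u {x} {y} g v b∈ p c∈ q (inj₂ y-crosses) = [] , g , refl
  , (subst₂ _⇝*_ (++-assoc u [ x ] _) (++-assoc u [ x ] _)
       (Star.reverse ⇝-sym (cross (u ++ [ x ]) y g v (∈-++⁺ˡ b∈) c∈
         (λ z∈ → y-crosses z∈ (Between-sym p)) (λ z∈ → y-crosses z∈ (Between-sym q))))
     ◅◅ move u (g ++ v) b∈ p (∈-++⁺ʳ g c∈) q ◅ ε)

-- Only the positions of h change, not the word h itself, so exchanges inside h can be lifted
-- afterwards.
lift-⇝ : ∀ {v v′ h π} → Separated v h → v ⇝ v′ → Interleaving v h π →
         ∃ λ π′ → π ⇝* π′ × Interleaving v′ h π′
lift-⇝ sep (move u {x} {y} v {b} {c} b∈ p c∈ q) i with split-++ u i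
... | u′ , _ , h₁ , _ , refl , refl , iu , i₁ with split-∷ i₁
... | k , _ , _ , refl , refl , i₂ with split-∷ i₂
-- `k` consists of the letters of h between u and x, and `g` of those that separate x from y in π.
... | g , v′ , h₂ , refl , refl , iv
  with swap-across (u′ ++ k) g v′ b∈′ p c∈′ q (gap (sep (∈-++⁺ʳ u (here refl)) (∈-++⁺ʳ u (there (here refl)))))
  where
  b∈′ : b ∈ u′ ++ k
  b∈′ = ∈-++⁺ˡ (∈-resp-↭ (↭-sym (toPermutation iu)) (∈-++⁺ˡ b∈))
  c∈′ : c ∈ v′
  c∈′ = ∈-resp-↭ (↭-sym (toPermutation iv)) (∈-++⁺ˡ c∈)
  g⊆h : ∀ {z} → z ∈ g → z ∈ h₁ ++ k ++ g ++ h₂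
  g⊆h = ∈-++⁺ʳ h₁ ∘ ∈-++⁺ʳ k ∘ ∈-++⁺ˡ
  gap : ∀ {x y} → Crosses x y (h₁ ++ k ++ g ++ h₂) ⊎ Crosses y x (h₁ ++ k ++ g ++ h₂) →
        Crosses x y g ⊎ Crosses y x g
  gap (inj₁ cr) = inj₁ (cr ∘ g⊆h)
  gap (inj₂ cr) = inj₂ (cr ∘ g⊆h)
... | g₁ , g₂ , refl , ms =
    u′ ++ k ++ g₁ ++ y ∷ x ∷ g₂ ++ v′
  , subst₂ _⇝*_ (++-assoc u′ k _) (++-assoc u′ k _) ms
  , subst (λ h → Interleaving (u ++ y ∷ x ∷ v) (h₁ ++ k ++ h) (u′ ++ k ++ g₁ ++ y ∷ x ∷ g₂ ++ v′))
      (sym (++-assoc g₁ g₂ h₂))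
      (Interleaving.++⁺ iu (Interleaving.++⁺ (right-only k) (Interleaving.++⁺ (right-only g₁)
        (consˡ (consˡ (Interleaving.++⁺ (right-only g₂) iv))))))

⇝⇒↭ : ∀ {w w′} → w ⇝ w′ → w ↭ w′
⇝⇒↭ (move u v _ _ _ _) = ++⁺ˡ u (swap _ _ ↭-refl)

lift-⇝* : ∀ {v v′ h π} → Separated v h → v ⇝* v′ → Interleaving v h π →
          ∃ λ π′ → π ⇝* π′ × Interleaving v′ h π′
lift-⇝* sep ε        i = _ , ε , i
lift-⇝* {v} sep (_◅_ {j = w} m ms) i with lift-⇝ sep m i
... | _ , ns , j with lift-⇝* (λ x∈ y∈ → sep (w⊆v x∈) (w⊆v y∈)) ms j
  where
  w⊆v : ∀ {x} → x ∈ w → x ∈ v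
  w⊆v = ∈-resp-↭ (↭-sym (⇝⇒↭ m))
... | π′ , ns′ , k = π′ , ns ◅◅ ns′ , k

Below : List ℕ → List ℕ → Set
Below v h = ∀ {x g} → x ∈ v → g ∈ h → x < g

-- The smaller letter crosses: what lies strictly between x < y also lies between x and anything
-- above y.
Below⇒Separatedˡ : ∀ {v h} → Below v h → Separated v h
Below⇒Separatedˡ v<h {x} {y} x∈ y∈ with ≤-total x y
... | inj₁ x≤y = inj₁ λ where
  g∈ (inj₁ (x<b , b<y)) → inj₁ (x<b , <-trans b<y (v<h y∈ g∈))
  g∈ (inj₂ (y<b , b<x)) → contradiction (<-trans y<b b<x) (≤⇒≯ x≤y)
... | inj₂ y≤x = inj₂ λ where
  g∈ (inj₁ (y<b , b<x)) → inj₁ (y<b , <-trans b<x (v<h x∈ g∈))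
  g∈ (inj₂ (x<b , b<y)) → contradiction (<-trans x<b b<y) (≤⇒≯ y≤x)

-- Dually, the larger of the two letters crosses.
Below⇒Separatedʳ : ∀ {v h} → Below v h → Separated h v
Below⇒Separatedʳ v<h {x} {y} x∈ y∈ with ≤-total x y
... | inj₁ x≤y = inj₂ λ where
  g∈ (inj₂ (x<b , b<y)) → inj₂ (<-trans (v<h g∈ x∈) x<b , b<y)
  g∈ (inj₁ (y<b , b<x)) → contradiction (<-trans y<b b<x) (≤⇒≯ x≤y)
... | inj₂ y≤x = inj₁ λ where
  g∈ (inj₂ (y<b , b<x)) → inj₂ (<-trans (v<h g∈ y∈) y<b , b<x)
  g∈ (inj₁ (x<b , b<y)) → contradiction (<-trans x<b b<y) (≤⇒≯ y≤x)

lift-≈ᴮ : ∀ {v v′ h h′ π} → Below v h → Unique v′ → Unique h′ → v ↭ v′ → h ↭ h′ →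
          v ≈ᴮ v′ → h ≈ᴮ h′ → Interleaving v h π →
          ∃ λ π′ → π ≈ᴮ π′ × Interleaving v′ h′ π′
lift-≈ᴮ {v} {v′} {h} {h′} v<h uv uh v↭ h↭ ev eh i
  with lift-⇝* (Below⇒Separatedˡ v<h) (≈ᴮ⇒⇝* [] v v′ uv v↭ ev) i
... | _ , ms , j
  with lift-⇝* (Below⇒Separatedʳ v′<h) (≈ᴮ⇒⇝* [] h h′ uh h↭ eh) (Interleaving.swap j)
  where
  v′<h : Below v′ h
  v′<h x∈ = v<h (∈-resp-↭ (↭-sym v↭) x∈)
... | π′ , ns , k = π′ , ⇝*⇒≈ᴮ (ms ◅◅ ns) , Interleaving.swap k

-- The permutohedron order on shuffles

infix 4 _⋖*_

_⋖*_ : List ℕ → List ℕ → Set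
_⋖*_ = Star _⋖_

⋖*-++ˡ : ∀ u {w w′} → w ⋖* w′ → (u ++ w) ⋖* (u ++ w′)
⋖*-++ˡ []      s = s
⋖*-++ˡ (x ∷ u) s = Star.gmap (x ∷_) (∷-⋖ x) (⋖*-++ˡ u s)

⋖*-++ʳ : ∀ v {w w′} → w ⋖* w′ → (w ++ v) ⋖* (w′ ++ v)
⋖*-++ʳ v = Star.gmap (_++ v) λ { (exchange u w a<b) →
  subst₂ _⋖_ (sym (++-assoc u _ v)) (sym (++-assoc u _ v)) (exchange u (w ++ v) a<b) }

⋖*-++ : ∀ {v v′ w w′} → v ⋖* v′ → w ⋖* w′ → (v ++ w) ⋖* (v′ ++ w′)
⋖*-++ {v′ = v′} {w} p q = ⋖*-++ʳ w p ◅◅ ⋖*-++ˡ v′ q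

raise : ∀ v {g h} → (∀ {x} → x ∈ v → x < g) → (v ++ g ∷ h) ⋖* (g ∷ v ++ h)
raise []      _ = ε
raise (x ∷ v) {h = h} l = ⋖*-++ˡ [ x ] (raise v (l ∘ there)) ◅◅ exchange [] (v ++ h) (l (here refl)) ◅ ε

lower : ∀ h {x v} → (∀ {g} → g ∈ h → x < g) → (x ∷ h ++ v) ⋖* (h ++ x ∷ v)
lower []      _ = ε
lower (g ∷ h) {v = v} l = exchange [] (h ++ v) (l (here refl)) ◅ ⋖*-++ˡ [ g ] (lower h (l ∘ there))

-- Each letter of h is pulled forward over the letters of v that are to follow it, all of which are
-- smaller.
concat-⋖*-interleaving : ∀ {v h π} → Below v h → Interleaving v h π → (v ++ h) ⋖* π
concat-⋖*-interleaving l []        = ε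
concat-⋖*-interleaving l (consˡ i) = ⋖*-++ˡ [ _ ] (concat-⋖*-interleaving (l ∘ there) i)
concat-⋖*-interleaving {v} l (consʳ i) =
  raise v (λ x∈ → l x∈ (here refl)) ◅◅ ⋖*-++ˡ [ _ ] (concat-⋖*-interleaving (λ x∈ → l x∈ ∘ there) i)

interleaving-⋖*-concat : ∀ {v h π} → Below v h → Interleaving v h π → π ⋖* (h ++ v)
interleaving-⋖*-concat l []        = ε
interleaving-⋖*-concat {h = h} l (consˡ i) =
  ⋖*-++ˡ [ _ ] (interleaving-⋖*-concat (l ∘ there) i) ◅◅ lower h (l (here refl))
interleaving-⋖*-concat l (consʳ i) = ⋖*-++ˡ [ _ ] (interleaving-⋖*-concat (λ x∈ → l x∈ ∘ there) i)

-- Search trees of permutations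

inorder : LTree → List ℕ
inorder (leaf _)     = []
inorder (node l b r) = inorder l ++ b ∷ inorder r

inorder-insert : ∀ a t → inorder (insert a t) ↭ a ∷ inorder t
inorder-insert a (leaf _) = ↭-refl
inorder-insert a (node l b r) with ≤-<-connex a b
... | inj₁ a≤b rewrite insert-≤ l r a≤b = ++⁺ʳ _ (inorder-insert a l)
... | inj₂ b<a rewrite insert-> l r b<a =
  ↭-trans (++⁺ˡ (inorder l) (↭-trans (prep b (inorder-insert a r)) (swap b a ↭-refl)))
    (shift a (inorder l) _)

inorder-bst : ∀ w → inorder (bst w) ↭ w
inorder-bst []      = ↭-refl
inorder-bst (a ∷ w) = ↭-trans (inorder-insert a (bst w)) (prep a (inorder-bst w))

data Search : LTree → Set where
  leaf : Search (leaf tt)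
  node : ∀ {l b r} → All (_≤ b) (inorder l) → All (b ≤_) (inorder r) →
         Search l → Search r → Search (node l b r)

Search-insert : ∀ a {t} → Search t → Search (insert a t)
Search-insert a leaf = node [] [] leaf leaf
Search-insert a (node {l} {b} {r} p q sl sr) with ≤-<-connex a b
... | inj₁ a≤b rewrite insert-≤ l r a≤b =
  node (All-resp-↭ (↭-sym (inorder-insert a l)) (a≤b ∷ p)) q (Search-insert a sl) sr
... | inj₂ b<a rewrite insert-> l r b<a =
  node p (All-resp-↭ (↭-sym (inorder-insert a r)) (<⇒≤ b<a ∷ q)) sl (Search-insert a sr)

Search-bst : ∀ w → Search (bst w)
Search-bst []      = leaf
Search-bst (a ∷ w) = Search-insert a (Search-bst w)

Search⇒sorted : ∀ {t} → Search t → AllPairs _≤_ (inorder t)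
Search⇒sorted leaf            = []
Search⇒sorted (node p q sl sr) = AllPairs.++⁺ (Search⇒sorted sl) (q ∷ Search⇒sorted sr)
  (All.map (λ x≤b → x≤b ∷ All.map (≤-trans x≤b) q) p)

sorted-↭⇒≡ : ∀ {v w} → AllPairs _≤_ v → AllPairs _≤_ w → v ↭ w → v ≡ w
sorted-↭⇒≡ {v} {[]} _ _ p = ↭-empty-inv p
sorted-↭⇒≡ {[]} {b ∷ w} _ _ p = sym (↭-empty-inv (↭-sym p))
sorted-↭⇒≡ {a ∷ v} {b ∷ w} (a≤ ∷ s) (b≤ ∷ s′) p
  with refl ← ≤-antisym (All.lookup (≤-refl ∷ a≤) (∈-resp-↭ (↭-sym p) (here refl)))
                        (All.lookup (≤-refl ∷ b≤) (∈-resp-↭ p (here refl)))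
  = cong (a ∷_) (sorted-↭⇒≡ s s′ (drop-∷ p))

range-sorted : ∀ n → AllPairs _≤_ (range n)
range-sorted n = subst (AllPairs _≤_) (sym (map-upTo suc n))
  (AllPairs.applyUpTo⁺₁ suc n λ i<j _ → s≤s (<⇒≤ i<j))

range-unique : ∀ n → Unique (range n)
range-unique n = Unique.map⁺ suc-injective (Unique.upTo⁺ n)

inorder-bst-range : ∀ {n} w → w ↭ range n → inorder (bst w) ≡ range n
inorder-bst-range {n} w p = sorted-↭⇒≡ (Search⇒sorted (Search-bst w)) (range-sorted n)
  (↭-trans (inorder-bst w) p)

length-inorder : ∀ t → length (inorder t) ≡ #nodes t
length-inorder (leaf _)     = refl
length-inorder (node l b r) = trans (length-++ (inorder l))
  (cong₂ (λ i j → i + suc j) (length-inorder l) (length-inorder r))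

#nodes-shape : ∀ t → #nodes (shape t) ≡ #nodes t
#nodes-shape = #nodes-mapₙ (const tt)

#nodes-bst : ∀ {n} w → w ↭ range n → #nodes (shape (bst w)) ≡ n
#nodes-bst {n} w p = trans (#nodes-shape (bst w)) (trans (sym (length-inorder (bst w)))
  (trans (cong length (inorder-bst-range w p)) (length-range n)))

++-injective : ∀ (u u′ : List ℕ) {v v′} → length u ≡ length u′ → u ++ v ≡ u′ ++ v′ → u ≡ u′ × v ≡ v′
++-injective []      []        _ e = refl , e
++-injective (a ∷ u) (a′ ∷ u′) l e with ∷-injective e
... | refl , e′ with ++-injective u u′ (suc-injective l) e′
...   | refl , e″ = refl , e″

node-injective : ∀ {l l′ r r′ : BT} → node l tt r ≡ node l′ tt r′ → l ≡ l′ × r ≡ r′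
node-injective refl = refl , refl

tree-ext : ∀ t t′ → shape t ≡ shape t′ → inorder t ≡ inorder t′ → t ≡ t′
tree-ext (leaf _)     (leaf _)        _ _ = refl
tree-ext (node l b r) (node l′ b′ r′) e f with node-injective e
... | el , er with ++-injective (inorder l) (inorder l′) lengths f
  where
  lengths : length (inorder l) ≡ length (inorder l′)
  lengths = begin
    length (inorder l)  ≡⟨ length-inorder l ⟩
    #nodes l            ≡⟨ #nodes-shape l ⟨
    #nodes (shape l)    ≡⟨ cong #nodes el ⟩
    #nodes (shape l′)   ≡⟨ #nodes-shape l′ ⟩
    #nodes l′           ≡⟨ length-inorder l′ ⟨
    length (inorder l′) ∎
    where open ≡-Reasoning
... | fl , fr with ∷-injective fr
... | refl , fr′ = cong₂ (λ l r → node l b r) (tree-ext l l′ el fl) (tree-ext r r′ er fr′)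

-- The labels are k + 1, …, k + n from left to right.
label : ℕ → BT → LTree
label k (leaf _)     = leaf tt
label k (node l _ r) = node (label k l) (suc (k + #nodes l)) (label (suc (k + #nodes l)) r)

shape-label : ∀ k t → shape (label k t) ≡ t
shape-label k (leaf _)     = refl
shape-label k (node l _ r) = cong₂ (λ l r → node l tt r) (shape-label k l) (shape-label _ r)

range-suc : ∀ n → range (suc n) ≡ 1 ∷ map suc (range n)
range-suc n = range-+ 1 n

inorder-label : ∀ k t → inorder (label k t) ≡ map (k +_) (range (#nodes t))
inorder-label k (leaf _)     = refl
inorder-label k (node l _ r) = begin
  inorder (label k l) ++ b ∷ inorder (label b r)
    ≡⟨ cong₂ (λ u v → u ++ b ∷ v) (inorder-label k l) (inorder-label b r) ⟩
  map (k +_) (range i) ++ b ∷ map (b +_) (range j)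
    ≡⟨ cong (map (k +_) (range i) ++_) (cong₂ _∷_ b≡ tail≡) ⟩
  map (k +_) (range i) ++ map (k +_) (map (i +_) (1 ∷ map suc (range j)))
    ≡⟨ map-++ (k +_) (range i) _ ⟨
  map (k +_) (range i ++ map (i +_) (1 ∷ map suc (range j)))
    ≡⟨ cong (λ v → map (k +_) (range i ++ map (i +_) v)) (range-suc j) ⟨
  map (k +_) (range i ++ map (i +_) (range (suc j)))
    ≡⟨ cong (map (k +_)) (range-+ i (suc j)) ⟨
  map (k +_) (range (i + suc j)) ∎
  where
  open ≡-Reasoning
  i = #nodes l
  j = #nodes r
  b = suc (k + i)
  b≡ : b ≡ k + (i + 1)
  b≡ = trans (+-comm 1 (k + i)) (+-assoc k i 1)
  b+ : ∀ x → b + x ≡ k + (i + suc x)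
  b+ x = trans (sym (+-suc (k + i) x)) (+-assoc k i (suc x))
  tail≡ : map (b +_) (range j) ≡ map (k +_) (map (i +_) (map suc (range j)))
  tail≡ = trans (map-cong b+ (range j)) (trans (map-∘ (range j)) (cong (map (k +_)) (map-∘ (range j))))

-- The infix word of a search tree is sorted, hence is 1 ... n here, and shape and infix word
-- determine a labelled tree. So the shape loses no information.
bst≡label : ∀ {n} w → w ↭ range n → bst w ≡ label 0 (shape (bst w))
bst≡label {n} w p = tree-ext (bst w) _ (sym (shape-label 0 (shape (bst w)))) (begin
  inorder (bst w)                               ≡⟨ inorder-bst-range w p ⟩
  range n                                       ≡⟨ map-id (range n) ⟨
  map (0 +_) (range n)                          ≡⟨ cong (map (0 +_) ∘ range) (#nodes-bst w p) ⟨
  map (0 +_) (range (#nodes (shape (bst w))))   ≡⟨ inorder-label 0 (shape (bst w)) ⟨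
  inorder (label 0 (shape (bst w)))             ∎)
  where open ≡-Reasoning

-- `𝖯` on words. Left-to-right insertion is written as right-to-left insertion of the reversed word,
-- so that facts about `bst` serve both trees.
shapes : List ℕ → BT × BT
shapes w = shape (bst (reverse w)) , shape (bst w)

𝖯≡shapes : ∀ {n} (σ : 𝔖 n) → 𝖯 σ ≡ shapes (word σ)
𝖯≡shapes σ = cong (λ t → shape t , shape (bst (word σ))) (sym (reverse-foldr insert (leaf tt) (word σ)))

,-injective : ∀ {a a′ b b′ : BT} → (a , b) ≡ (a′ , b′) → a ≡ a′ × b ≡ b′
,-injective refl = refl , refl

↭-reverse′ : ∀ {n} {w : List ℕ} → w ↭ range n → reverse w ↭ range n
↭-reverse′ p = ↭-trans (↭-reverse _) p

shapes⇒≈ᴮ : ∀ {n v w} → v ↭ range n → w ↭ range n → shapes v ≡ shapes w → v ≈ᴮ w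
shapes⇒≈ᴮ {n} {v} {w} p q e =
    bst-injective (↭-reverse′ p) (↭-reverse′ q) (proj₁ (,-injective e))
  , bst-injective p q (proj₂ (,-injective e))
  where
  bst-injective : ∀ {v w} → v ↭ range n → w ↭ range n → shape (bst v) ≡ shape (bst w) → bst v ≡ bst w
  bst-injective {v} {w} p q e = trans (bst≡label v p) (trans (cong (label 0) e) (sym (bst≡label w q)))

≈ᴮ⇒shapes : ∀ {v w} → v ≈ᴮ w → shapes v ≡ shapes w
≈ᴮ⇒shapes (p , q) = cong₂ (λ s t → shape s , shape t) p q

-- Grafting and the P-symbols of concatenations

infixl 6 _/ˡ_ _∖ˡ_

_/ˡ_ : LTree → LTree → LTree
t /ˡ leaf _     = t
t /ˡ node l b r = node (t /ˡ l) b r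

_∖ˡ_ : LTree → LTree → LTree
leaf _     ∖ˡ t = t
node l b r ∖ˡ t = node l b (r ∖ˡ t)

shape-/ : ∀ s t → shape (s /ˡ t) ≡ shape s /ᵗ shape t
shape-/ s (leaf _)     = refl
shape-/ s (node l b r) = cong (λ l → node l tt (shape r)) (shape-/ s l)

shape-∖ : ∀ s t → shape (s ∖ˡ t) ≡ shape s ∖ᵗ shape t
shape-∖ (leaf _)     t = refl
shape-∖ (node l b r) t = cong (node (shape l) tt) (shape-∖ r t)

label-/ : ∀ k s t → label k (s /ᵗ t) ≡ label k s /ˡ label (k + #nodes s) t
label-/ k s (leaf _)     = refl
label-/ k s (node l _ r)
  rewrite label-/ k s l | #nodes-/ s l | +-assoc k (#nodes s) (#nodes l) = refl

label-∖ : ∀ k s t → label k (s ∖ᵗ t) ≡ label k s ∖ˡ label (k + #nodes s) t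
label-∖ k (leaf _)     t = cong (λ i → label i t) (sym (+-identityʳ k))
label-∖ k (node l _ r) t
  rewrite label-∖ (suc (k + #nodes l)) r t
        | sym (+-suc (k + #nodes l) (#nodes r)) | +-assoc k (#nodes l) (suc (#nodes r)) = refl

All-node⁻ : ∀ {P : ℕ → Set} l {b} r → All P (inorder (node l b r)) →
            All P (inorder l) × P b × All P (inorder r)
All-node⁻ l r a with All.++⁻ (inorder l) a
... | al , p ∷ ar = al , p , ar

insert-/ : ∀ {a} s t → All (a ≤_) (inorder t) → insert a (s /ˡ t) ≡ insert a s /ˡ t
insert-/ s (leaf _)     _ = refl
insert-/ s (node l b r) h with All-node⁻ l r h
... | hl , a≤b , _ rewrite insert-≤ (s /ˡ l) r a≤b = cong (λ l → node l b r) (insert-/ s l hl)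

insert-∖ : ∀ {a} s t → All (_< a) (inorder s) → insert a (s ∖ˡ t) ≡ s ∖ˡ insert a t
insert-∖ (leaf _)     t _ = refl
insert-∖ (node l b r) t h with All-node⁻ l r h
... | _ , b<a , hr rewrite insert-> l (r ∖ˡ t) b<a = cong (node l b) (insert-∖ r t hr)

All-inorder-bst : ∀ {P : ℕ → Set} w → (∀ {x} → x ∈ w → P x) → All P (inorder (bst w))
All-inorder-bst w h = All.tabulate (h ∘ ∈-resp-↭ (inorder-bst w))

-- The letters of v are inserted first; those of u then all go down to the leftmost leaf and build
-- `bst u` there.
bst-++-/ : ∀ u v → Below u v → bst (u ++ v) ≡ bst u /ˡ bst v
bst-++-/ []      v _ = sym (leaf-/ˡ (bst v))
  where
  leaf-/ˡ : ∀ t → leaf tt /ˡ t ≡ t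
  leaf-/ˡ (leaf _)     = refl
  leaf-/ˡ (node l b r) = cong (λ l → node l b r) (leaf-/ˡ l)
bst-++-/ (a ∷ u) v h = trans (cong (insert a) (bst-++-/ u v (h ∘ there)))
  (insert-/ (bst u) (bst v) (All-inorder-bst v (<⇒≤ ∘ h (here refl))))

bst-++-∖ : ∀ u v → Below u v → bst (v ++ u) ≡ bst u ∖ˡ bst v
bst-++-∖ u []      _ = sym (∖ˡ-leaf (bst u))
  where
  ∖ˡ-leaf : ∀ t → t ∖ˡ leaf tt ≡ t
  ∖ˡ-leaf (leaf _)     = refl
  ∖ˡ-leaf (node l b r) = cong (node l b) (∖ˡ-leaf r)
bst-++-∖ u (a ∷ v) h = trans (cong (insert a) (bst-++-∖ u v (λ x∈ → h x∈ ∘ there)))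
  (insert-∖ (bst u) (bst v) (All-inorder-bst u (λ x∈ → h x∈ (here refl))))

insert-shift : ∀ m a t → insert (m + a) (mapₙ (m +_) t) ≡ mapₙ (m +_) (insert a t)
insert-shift m a (leaf _) = refl
insert-shift m a (node l b r) with ≤-<-connex a b
... | inj₁ a≤b rewrite insert-≤ l r a≤b | insert-≤ (mapₙ (m +_) l) (mapₙ (m +_) r) (+-monoʳ-≤ m a≤b)
  = cong (λ l → node l (m + b) (mapₙ (m +_) r)) (insert-shift m a l)
... | inj₂ b<a rewrite insert-> l r b<a | insert-> (mapₙ (m +_) l) (mapₙ (m +_) r) (+-monoʳ-< m b<a)
  = cong (node (mapₙ (m +_) l) (m + b)) (insert-shift m a r)

bst-shift : ∀ m w → bst (map (m +_) w) ≡ mapₙ (m +_) (bst w)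
bst-shift m []      = refl
bst-shift m (a ∷ w) = trans (cong (insert (m + a)) (bst-shift m w)) (insert-shift m a (bst w))

shape-shift : ∀ m t → shape (mapₙ (m +_) t) ≡ shape t
shape-shift m (leaf _)     = refl
shape-shift m (node l b r) = cong₂ (λ l r → node l tt r) (shape-shift m l) (shape-shift m r)

shape-bst-shift : ∀ m w → shape (bst (map (m +_) w)) ≡ shape (bst w)
shape-bst-shift m w = trans (cong shape (bst-shift m w)) (shape-shift m (bst w))

shapes-shift : ∀ m w → shapes (map (m +_) w) ≡ shapes w
shapes-shift m w = cong₂ _,_
  (trans (cong (shape ∘ bst) (sym (reverse-map (m +_) w))) (shape-bst-shift m (reverse w)))
  (shape-bst-shift m w)

infixl 6 _/²_ _∖²_

-- The two components graft on opposite sides because the left tree belongs to the reversed word,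
-- where the factors are in the opposite order.
_/²_ _∖²_ : BT × BT → BT × BT → BT × BT
(s , t) /² (s′ , t′) = s ∖ᵗ s′ , t /ᵗ t′
(s , t) ∖² (s′ , t′) = s /ᵗ s′ , t ∖ᵗ t′

Below-reverse : ∀ {u v} → Below u v → Below (reverse u) (reverse v)
Below-reverse {u} {v} h x∈ g∈ = h (∈-reverse⁻ u x∈) (∈-reverse⁻ v g∈)

shapes-++-/ : ∀ u v → Below u v → shapes (u ++ v) ≡ shapes u /² shapes v
shapes-++-/ u v h = cong₂ _,_
  (begin
    shape (bst (reverse (u ++ v)))                    ≡⟨ cong (shape ∘ bst) (reverse-++ u v) ⟩
    shape (bst (reverse v ++ reverse u))              ≡⟨ cong shape (bst-++-∖ (reverse u) (reverse v) (Below-reverse h)) ⟩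
    shape (bst (reverse u) ∖ˡ bst (reverse v))        ≡⟨ shape-∖ (bst (reverse u)) _ ⟩
    shape (bst (reverse u)) ∖ᵗ shape (bst (reverse v)) ∎)
  (trans (cong shape (bst-++-/ u v h)) (shape-/ (bst u) (bst v)))
  where open ≡-Reasoning

shapes-++-∖ : ∀ u v → Below u v → shapes (v ++ u) ≡ shapes u ∖² shapes v
shapes-++-∖ u v h = cong₂ _,_
  (begin
    shape (bst (reverse (v ++ u)))                    ≡⟨ cong (shape ∘ bst) (reverse-++ v u) ⟩
    shape (bst (reverse u ++ reverse v))              ≡⟨ cong shape (bst-++-/ (reverse u) (reverse v) (Below-reverse h)) ⟩
    shape (bst (reverse u) /ˡ bst (reverse v))        ≡⟨ shape-/ (bst (reverse u)) _ ⟩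
    shape (bst (reverse u)) /ᵗ shape (bst (reverse v)) ∎)
  (trans (cong shape (bst-++-∖ u v h)) (shape-∖ (bst u) (bst v)))
  where open ≡-Reasoning

-- Small and large letters of a permutation

-- In a search tree a root above m has only letters above m on its right, so removing the root
-- leaves a single subtree and nothing has to be merged; dually for `high`.
low high : ℕ → LTree → LTree
low m (leaf _)      = leaf tt
low m (node l b r)  = if does (b ≤? m) then node (low m l) b (low m r) else low m l
high m (leaf _)     = leaf tt
high m (node l b r) = if does (m <? b) then node (high m l) b (high m r) else high m r

module _ {m : ℕ} where

  low-≤ : ∀ {b} l r → b ≤ m → low m (node l b r) ≡ node (low m l) b (low m r)
  low-≤ {b} l r h rewrite dec-true (b ≤? m) h = refl

  low-> : ∀ {b} l r → m < b → low m (node l b r) ≡ low m l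
  low-> {b} l r h rewrite dec-false (b ≤? m) (<⇒≱ h) = refl

  high-> : ∀ {b} l r → m < b → high m (node l b r) ≡ node (high m l) b (high m r)
  high-> {b} l r h rewrite dec-true (m <? b) h = refl

  high-≤ : ∀ {b} l r → b ≤ m → high m (node l b r) ≡ high m r
  high-≤ {b} l r h rewrite dec-false (m <? b) (≤⇒≯ h) = refl

  -- A root above m sends a to the left, into the very subtree that `low` keeps.
  low-insert-≤ : ∀ {a} t → a ≤ m → low m (insert a t) ≡ insert a (low m t)
  low-insert-≤ {a} (leaf _) a≤m = low-≤ (leaf tt) (leaf tt) a≤m
  low-insert-≤ {a} (node l b r) a≤m with ≤-<-connex a b | ≤-<-connex b m
  ... | inj₁ a≤b | inj₁ b≤m rewrite insert-≤ l r a≤b | low-≤ (insert a l) r b≤m | low-≤ l r b≤m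
    | insert-≤ (low m l) (low m r) a≤b = cong (λ l → node l b (low m r)) (low-insert-≤ l a≤m)
  ... | inj₁ a≤b | inj₂ m<b rewrite insert-≤ l r a≤b | low-> (insert a l) r m<b | low-> l r m<b
    = low-insert-≤ l a≤m
  ... | inj₂ b<a | inj₁ b≤m rewrite insert-> l r b<a | low-≤ l (insert a r) b≤m | low-≤ l r b≤m
    | insert-> (low m l) (low m r) b<a = cong (node (low m l) b) (low-insert-≤ r a≤m)
  ... | inj₂ b<a | inj₂ m<b = contradiction a≤m (<⇒≱ (<-trans m<b b<a))

  low-insert-> : ∀ {a} t → m < a → low m (insert a t) ≡ low m t
  low-insert-> {a} (leaf _) m<a = low-> (leaf tt) (leaf tt) m<a
  low-insert-> {a} (node l b r) m<a with ≤-<-connex a b | ≤-<-connex b m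
  ... | inj₁ a≤b | inj₁ b≤m = contradiction m<a (≤⇒≯ (≤-trans a≤b b≤m))
  ... | inj₁ a≤b | inj₂ m<b rewrite insert-≤ l r a≤b | low-> (insert a l) r m<b | low-> l r m<b
    = low-insert-> l m<a
  ... | inj₂ b<a | inj₁ b≤m rewrite insert-> l r b<a | low-≤ l (insert a r) b≤m | low-≤ l r b≤m
    = cong (node (low m l) b) (low-insert-> r m<a)
  ... | inj₂ b<a | inj₂ m<b rewrite insert-> l r b<a | low-> l (insert a r) m<b | low-> l r m<b = refl

  high-insert-> : ∀ {a} t → m < a → high m (insert a t) ≡ insert a (high m t)
  high-insert-> {a} (leaf _) m<a = high-> (leaf tt) (leaf tt) m<a
  high-insert-> {a} (node l b r) m<a with ≤-<-connex a b | ≤-<-connex b m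
  ... | inj₁ a≤b | inj₁ b≤m = contradiction m<a (≤⇒≯ (≤-trans a≤b b≤m))
  ... | inj₁ a≤b | inj₂ m<b rewrite insert-≤ l r a≤b | high-> (insert a l) r m<b | high-> l r m<b
    | insert-≤ (high m l) (high m r) a≤b = cong (λ l → node l b (high m r)) (high-insert-> l m<a)
  ... | inj₂ b<a | inj₁ b≤m rewrite insert-> l r b<a | high-≤ l (insert a r) b≤m | high-≤ l r b≤m
    = high-insert-> r m<a
  ... | inj₂ b<a | inj₂ m<b rewrite insert-> l r b<a | high-> l (insert a r) m<b | high-> l r m<b
    | insert-> (high m l) (high m r) b<a = cong (node (high m l) b) (high-insert-> r m<a)

  high-insert-≤ : ∀ {a} t → a ≤ m → high m (insert a t) ≡ high m t
  high-insert-≤ {a} (leaf _) a≤m = high-≤ (leaf tt) (leaf tt) a≤m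
  high-insert-≤ {a} (node l b r) a≤m with ≤-<-connex a b | ≤-<-connex b m
  ... | inj₁ a≤b | inj₁ b≤m rewrite insert-≤ l r a≤b | high-≤ (insert a l) r b≤m | high-≤ l r b≤m = refl
  ... | inj₁ a≤b | inj₂ m<b rewrite insert-≤ l r a≤b | high-> (insert a l) r m<b | high-> l r m<b
    = cong (λ l → node l b (high m r)) (high-insert-≤ l a≤m)
  ... | inj₂ b<a | inj₁ b≤m rewrite insert-> l r b<a | high-≤ l (insert a r) b≤m | high-≤ l r b≤m
    = high-insert-≤ r a≤m
  ... | inj₂ b<a | inj₂ m<b = contradiction a≤m (<⇒≱ (<-trans m<b b<a))

  low-all : ∀ t → All (_≤ m) (inorder t) → low m t ≡ t
  low-all (leaf _)     _ = refl
  low-all (node l b r) h with All-node⁻ l r h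
  ... | hl , b≤m , hr rewrite low-≤ l r b≤m = cong₂ (λ l r → node l b r) (low-all l hl) (low-all r hr)

  low-none : ∀ t → All (m <_) (inorder t) → low m t ≡ leaf tt
  low-none (leaf _)     _ = refl
  low-none (node l b r) h with All-node⁻ l r h
  ... | hl , m<b , hr rewrite low-> l r m<b = low-none l hl

  high-all : ∀ t → All (m <_) (inorder t) → high m t ≡ t
  high-all (leaf _)     _ = refl
  high-all (node l b r) h with All-node⁻ l r h
  ... | hl , m<b , hr rewrite high-> l r m<b = cong₂ (λ l r → node l b r) (high-all l hl) (high-all r hr)

  high-none : ∀ t → All (_≤ m) (inorder t) → high m t ≡ leaf tt
  high-none (leaf _)     _ = refl
  high-none (node l b r) h with All-node⁻ l r h
  ... | hl , b≤m , hr rewrite high-≤ l r b≤m = high-none r hr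

  module _ {s : LTree} (s≤m : All (_≤ m) (inorder s)) where

    low-/ : ∀ t → All (m <_) (inorder t) → low m (s /ˡ t) ≡ s
    low-/ (leaf _)     _ = low-all s s≤m
    low-/ (node l b r) h with All-node⁻ l r h
    ... | hl , m<b , _ rewrite low-> (s /ˡ l) r m<b = low-/ l hl

    high-/ : ∀ t → All (m <_) (inorder t) → high m (s /ˡ t) ≡ t
    high-/ (leaf _)     _ = high-none s s≤m
    high-/ (node l b r) h with All-node⁻ l r h
    ... | hl , m<b , hr rewrite high-> (s /ˡ l) r m<b =
      cong₂ (λ l r → node l b r) (high-/ l hl) (high-all r hr)

  module _ {t : LTree} (m<t : All (m <_) (inorder t)) where

    low-∖ : ∀ s → All (_≤ m) (inorder s) → low m (s ∖ˡ t) ≡ s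
    low-∖ (leaf _)     _ = low-none t m<t
    low-∖ (node l b r) h with All-node⁻ l r h
    ... | hl , b≤m , hr rewrite low-≤ l (r ∖ˡ t) b≤m =
      cong₂ (λ l r → node l b r) (low-all l hl) (low-∖ r hr)

    high-∖ : ∀ s → All (_≤ m) (inorder s) → high m (s ∖ˡ t) ≡ t
    high-∖ (leaf _)     _ = high-all t m<t
    high-∖ (node l b r) h with All-node⁻ l r h
    ... | hl , b≤m , hr rewrite high-≤ l (r ∖ˡ t) b≤m = high-∖ r hr

lows highs : ℕ → List ℕ → List ℕ
lows  m = filter (_≤? m)
highs m = filter (m <?_)

bst-lows : ∀ m w → bst (lows m w) ≡ low m (bst w)
bst-lows m []      = refl
bst-lows m (a ∷ w) with ≤-<-connex a m
... | inj₁ a≤m rewrite filter-accept (_≤? m) {xs = w} a≤m | low-insert-≤ (bst w) a≤m =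
  cong (insert a) (bst-lows m w)
... | inj₂ m<a rewrite filter-reject (_≤? m) {xs = w} (<⇒≱ m<a) | low-insert-> (bst w) m<a = bst-lows m w

bst-highs : ∀ m w → bst (highs m w) ≡ high m (bst w)
bst-highs m []      = refl
bst-highs m (a ∷ w) with ≤-<-connex a m
... | inj₁ a≤m rewrite filter-reject (m <?_) {xs = w} (≤⇒≯ a≤m) | high-insert-≤ (bst w) a≤m = bst-highs m w
... | inj₂ m<a rewrite filter-accept (m <?_) {xs = w} m<a | high-insert-> (bst w) m<a =
  cong (insert a) (bst-highs m w)

filter-reverse : ∀ {P : ℕ → Set} (P? : Decidable P) w → filter P? (reverse w) ≡ reverse (filter P? w)
filter-reverse P? []      = refl
filter-reverse P? (a ∷ w) = begin
  filter P? (reverse (a ∷ w))                 ≡⟨ cong (filter P?) (unfold-reverse a w) ⟩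
  filter P? (reverse w ++ [ a ])              ≡⟨ filter-++ P? (reverse w) [ a ] ⟩
  filter P? (reverse w) ++ filter P? [ a ]    ≡⟨ cong₂ _++_ (filter-reverse P? w) (sym singleton) ⟩
  reverse (filter P? w) ++ reverse (filter P? [ a ]) ≡⟨ reverse-++ (filter P? [ a ]) (filter P? w) ⟨
  reverse (filter P? [ a ] ++ filter P? w)    ≡⟨ cong reverse (filter-++ P? [ a ] w) ⟨
  reverse (filter P? (a ∷ w))                 ∎
  where
  open ≡-Reasoning
  singleton : reverse (filter P? [ a ]) ≡ filter P? [ a ]
  singleton with does (P? a)
  ... | true  = refl
  ... | false = refl

range-bounds : ∀ n {x} → x ∈ range n → 0 < x × x ≤ n
range-bounds n x∈ with ∈-map⁻ suc x∈
... | i , i∈ , refl = s≤s z≤n , ∈-upTo⁻ i∈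

-- For a permutation of 1 ... m + n, the standardization of its large letters. The subtraction is
-- never truncated, all these letters being above m.
rest : ℕ → List ℕ → List ℕ
rest m w = map (_∸ m) (highs m w)

highs≡map-rest : ∀ m w → highs m w ≡ map (m +_) (rest m w)
highs≡map-rest m w = begin
  highs m w                           ≡⟨ map-id-local (All.map (λ m<a → m+[n∸m]≡n (<⇒≤ m<a)) (All.all-filter (m <?_) w)) ⟨
  map (λ a → m + (a ∸ m)) (highs m w) ≡⟨ map-∘ (highs m w) ⟩
  map (m +_) (rest m w)               ∎
  where open ≡-Reasoning

map-+-∸ : ∀ m w → map (_∸ m) (map (m +_) w) ≡ w
map-+-∸ m w = trans (sym (map-∘ w)) (map-id-local (All.tabulate λ {x} _ → m+n∸m≡n m x))

module _ (m n : ℕ) where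

  lows-range : lows m (range (m + n)) ≡ range m
  lows-range = begin
    lows m (range (m + n))                                 ≡⟨ cong (lows m) (range-+ m n) ⟩
    lows m (range m ++ map (m +_) (range n))               ≡⟨ filter-++ (_≤? m) (range m) _ ⟩
    lows m (range m) ++ lows m (map (m +_) (range n))      ≡⟨ cong₂ _++_
      (filter-all (_≤? m) (All.tabulate (proj₂ ∘ range-bounds m)))
      (filter-none (_≤? m) (All.map⁺ (All.tabulate λ x∈ → <⇒≱ (m<m+n m (proj₁ (range-bounds n x∈)))))) ⟩
    range m ++ []                                          ≡⟨ ++-identityʳ (range m) ⟩
    range m                                                ∎
    where open ≡-Reasoning

  highs-range : highs m (range (m + n)) ≡ map (m +_) (range n)
  highs-range = begin
    highs m (range (m + n))                                ≡⟨ cong (highs m) (range-+ m n) ⟩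
    highs m (range m ++ map (m +_) (range n))              ≡⟨ filter-++ (m <?_) (range m) _ ⟩
    highs m (range m) ++ highs m (map (m +_) (range n))    ≡⟨ cong₂ _++_
      (filter-none (m <?_) (All.tabulate (≤⇒≯ ∘ proj₂ ∘ range-bounds m)))
      (filter-all (m <?_) (All.map⁺ (All.tabulate λ x∈ → m<m+n m (proj₁ (range-bounds n x∈))))) ⟩
    map (m +_) (range n)                                   ∎
    where open ≡-Reasoning

  module _ {w : List ℕ} (p : w ↭ range (m + n)) where

    lows-↭ : lows m w ↭ range m
    lows-↭ = ↭-trans (filter-↭ (_≤? m) p) (↭-reflexive lows-range)

    highs-↭ : highs m w ↭ map (m +_) (range n)
    highs-↭ = ↭-trans (filter-↭ (m <?_) p) (↭-reflexive highs-range)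

    rest-↭ : rest m w ↭ range n
    rest-↭ = ↭-trans (map⁺ (_∸ m) highs-↭) (↭-reflexive (map-+-∸ m (range n)))

  label-≤ : ∀ t → #nodes t ≡ m → All (_≤ m) (inorder (label 0 t))
  label-≤ t refl = subst (All (_≤ m)) (sym (trans (inorder-label 0 t) (map-id (range m))))
    (All.tabulate (proj₂ ∘ range-bounds m))

  label-> : ∀ t → All (m <_) (inorder (label m t))
  label-> t = subst (All (m <_)) (sym (inorder-label m t))
    (All.map⁺ (All.tabulate λ x∈ → m<m+n m (proj₁ (range-bounds (#nodes t) x∈))))

  module _ {s t : BT} {w : List ℕ} (p : w ↭ range (m + n)) (q : #nodes s ≡ m) where

    -- The shape forces the labels. In a graft, s receives 1 ... m, by its size, and t the letters
    -- above m, so cutting at m undoes the graft.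
    parts-/ : shape (bst w) ≡ s /ᵗ t → shape (bst (lows m w)) ≡ s × shape (bst (highs m w)) ≡ t
    parts-/ e =
        trans (cong shape (trans (bst-lows m w) (trans (cong (low m) bst≡) (low-/ (label-≤ s q) (label m t) (label-> t)))))
          (shape-label 0 s)
      , trans (cong shape (trans (bst-highs m w) (trans (cong (high m) bst≡) (high-/ (label-≤ s q) (label m t) (label-> t)))))
          (shape-label m t)
      where
      bst≡ : bst w ≡ label 0 s /ˡ label m t
      bst≡ = trans (bst≡label w p) (trans (cong (label 0) e)
        (trans (label-/ 0 s t) (cong (λ k → label 0 s /ˡ label k t) q)))

    parts-∖ : shape (bst w) ≡ s ∖ᵗ t → shape (bst (lows m w)) ≡ s × shape (bst (highs m w)) ≡ t
    parts-∖ e =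
        trans (cong shape (trans (bst-lows m w) (trans (cong (low m) bst≡) (low-∖ (label-> t) (label 0 s) (label-≤ s q)))))
          (shape-label 0 s)
      , trans (cong shape (trans (bst-highs m w) (trans (cong (high m) bst≡) (high-∖ (label-> t) (label 0 s) (label-≤ s q)))))
          (shape-label m t)
      where
      bst≡ : bst w ≡ label 0 s ∖ˡ label m t
      bst≡ = trans (bst≡label w p) (trans (cong (label 0) e)
        (trans (label-∖ 0 s t) (cong (λ k → label 0 s ∖ˡ label k t) q)))

Sized : ℕ → BT × BT → Set
Sized m (s , t) = #nodes s ≡ m × #nodes t ≡ m

shapes-reverse-lows : ∀ m w → shape (bst (lows m (reverse w))) ≡ shape (bst (reverse (lows m w)))
shapes-reverse-lows m w = cong (shape ∘ bst) (filter-reverse (_≤? m) w)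

shapes-reverse-highs : ∀ m w → shape (bst (highs m (reverse w))) ≡ shape (bst (reverse (highs m w)))
shapes-reverse-highs m w = cong (shape ∘ bst) (filter-reverse (m <?_) w)

shapes-highs : ∀ m w → shapes (highs m w) ≡ shapes (rest m w)
shapes-highs m w = trans (cong shapes (highs≡map-rest m w)) (shapes-shift m (rest m w))

shapes-parts-/ : ∀ m n {w x y} → w ↭ range (m + n) → Sized m x → shapes w ≡ x /² y →
                 shapes (lows m w) ≡ x × shapes (rest m w) ≡ y
shapes-parts-/ m n {w} p (q , q′) e with ,-injective e
... | eL , eR with parts-∖ m n (↭-reverse′ p) q eL | parts-/ m n p q′ eR
... | lL , hL | lR , hR =
    cong₂ _,_ (trans (sym (shapes-reverse-lows m w)) lL) lR
  , trans (sym (shapes-highs m w)) (cong₂ _,_ (trans (sym (shapes-reverse-highs m w)) hL) hR)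

shapes-parts-∖ : ∀ m n {w x y} → w ↭ range (m + n) → Sized m x → shapes w ≡ x ∖² y →
                 shapes (lows m w) ≡ x × shapes (rest m w) ≡ y
shapes-parts-∖ m n {w} p (q , q′) e with ,-injective e
... | eL , eR with parts-/ m n (↭-reverse′ p) q eL | parts-∖ m n p q′ eR
... | lL , hL | lR , hR =
    cong₂ _,_ (trans (sym (shapes-reverse-lows m w)) lL) lR
  , trans (sym (shapes-highs m w)) (cong₂ _,_ (trans (sym (shapes-reverse-highs m w)) hL) hR)

≈ᴮ-lows : ∀ m {v w} → v ≈ᴮ w → lows m v ≈ᴮ lows m w
≈ᴮ-lows m {v} {w} (p , q) =
    trans (cong bst (sym (filter-reverse (_≤? m) v))) (trans (bst-lows m (reverse v)) (trans (cong (low m) p)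
      (trans (sym (bst-lows m (reverse w))) (cong bst (filter-reverse (_≤? m) w)))))
  , trans (bst-lows m v) (trans (cong (low m) q) (sym (bst-lows m w)))

≈ᴮ-highs : ∀ m {v w} → v ≈ᴮ w → highs m v ≈ᴮ highs m w
≈ᴮ-highs m {v} {w} (p , q) =
    trans (cong bst (sym (filter-reverse (m <?_) v))) (trans (bst-highs m (reverse v)) (trans (cong (high m) p)
      (trans (sym (bst-highs m (reverse w))) (cong bst (filter-reverse (m <?_) w)))))
  , trans (bst-highs m v) (trans (cong (high m) q) (sym (bst-highs m w)))

-- The P-symbol of a permutation is a pair of twin binary trees

-- The side of the leaf where y would be inserted, that is, the letter of the
-- canopy between y - 1 and y.
side : Bool → ℕ → LTree → Bool
side s y (leaf _)     = s
side s y (node l b r) = if does (y ≤? b) then side true y l else side false y r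

side-≤ : ∀ s {y b} l r → y ≤ b → side s y (node l b r) ≡ side true y l
side-≤ s {y} {b} l r h rewrite dec-true (y ≤? b) h = refl

side-> : ∀ s {y b} l r → b < y → side s y (node l b r) ≡ side false y r
side-> s {y} {b} l r h rewrite dec-false (y ≤? b) (<⇒≱ h) = refl

-- As a search goes left on equality, the leaves are reached from left to right by searching for k +
-- 1, ..., k + i + 1, where i is the number of nodes.
leafSides≡side : ∀ s k t → leafSides s t ≡ map (λ y → side s (k + y) (label k t)) (range (suc (#nodes t)))
leafSides≡side s k (leaf _)     = refl
leafSides≡side s k (node l _ r) = begin
  leafSides true l ++ leafSides false r
    ≡⟨ cong₂ _++_ (leafSides≡side true k l) (leafSides≡side false b r) ⟩
  map (λ y → side true (k + y) L) (range (suc i)) ++ map (λ y → side false (b + y) R) (range (suc j))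
    ≡⟨ cong₂ _++_ (map-cong-local (All.tabulate λ y∈ → sym (side-≤ s L R (lt (proj₂ (range-bounds (suc i) y∈))))))
                  (map-cong-local (All.tabulate λ {y} y∈ → trans (sym (side-> s L R (m<m+n b (proj₁ (range-bounds (suc j) y∈)))))
                     (cong (λ z → side s z (node L b R)) (trans (cong suc (+-assoc k i y)) (sym (+-suc k (i + y))))))) ⟩
  map f (range (suc i)) ++ map (f ∘ (suc i +_)) (range (suc j))
    ≡⟨ cong (map f (range (suc i)) ++_) (map-∘ (range (suc j))) ⟩
  map f (range (suc i)) ++ map f (map (suc i +_) (range (suc j)))
    ≡⟨ map-++ f (range (suc i)) _ ⟨
  map f (range (suc i) ++ map (suc i +_) (range (suc j)))
    ≡⟨ cong (map f) (range-+ (suc i) (suc j)) ⟨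
  map f (range (suc (i + suc j))) ∎
  where
  open ≡-Reasoning
  i = #nodes l
  j = #nodes r
  b = suc (k + i)
  L = label k l
  R = label b r
  f = λ y → side s (k + y) (node L b R)
  lt : ∀ {y} → y ≤ suc i → k + y ≤ b
  lt {y} h = ≤-trans (+-monoʳ-≤ k h) (≤-reflexive (+-suc k i))

take-length-++ : ∀ (u v : List ℕ) → take (length u) (u ++ v) ≡ u
take-length-++ []      v = refl
take-length-++ (a ∷ u) v = cong (a ∷_) (take-length-++ u v)

-- Omitting the first and the last leaf removes the searches for 1 and for n + 2. The letter at
-- position y belongs to the leaf between y and y + 1.
canopy≡side : ∀ n {w} → w ↭ range (suc n) →
              canopy (shape (bst w)) ≡ map (λ y → side false (suc y) (bst w)) (range n)
canopy≡side n {w} p = begin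
  drop 1 (take (#nodes t) (leafSides false t))
    ≡⟨ cong₂ (λ k v → drop 1 (take k v)) nodes leaves ⟩
  drop 1 (take (suc n) (map f (range (suc (suc n)))))
    ≡⟨ cong (drop 1) (take-map (suc n) (range (suc (suc n)))) ⟩
  drop 1 (map f (take (suc n) (range (suc (suc n)))))
    ≡⟨ cong (λ v → drop 1 (map f v)) prefix ⟩
  drop 1 (map f (range (suc n)))
    ≡⟨ cong (λ v → drop 1 (map f v)) (range-suc n) ⟩
  map f (map suc (range n))
    ≡⟨ map-∘ (range n) ⟨
  map (f ∘ suc) (range n) ∎
  where
  open ≡-Reasoning
  t = shape (bst w)
  f = λ y → side false y (bst w)
  nodes : #nodes t ≡ suc n
  nodes = #nodes-bst w p
  leaves : leafSides false t ≡ map f (range (suc (suc n)))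
  leaves = trans (leafSides≡side false 0 t)
    (cong₂ (λ u k → map (λ y → side false y u) (range (suc k))) (sym (bst≡label w p)) nodes)
  prefix : take (suc n) (range (suc (suc n))) ≡ range (suc n)
  prefix = begin
    take (suc n) (range (suc (suc n)))                 ≡⟨ cong₂ (λ k j → take k (range j)) (sym (length-range (suc n))) (+-comm 1 (suc n)) ⟩
    take (length (range (suc n))) (range (suc n + 1))  ≡⟨ cong (take _) (range-+ (suc n) 1) ⟩
    take (length (range (suc n))) (range (suc n) ++ _) ≡⟨ take-length-++ (range (suc n)) _ ⟩
    range (suc n)                                      ∎

side-insert-same : ∀ s y t → side s y (insert y t) ≡ true
side-insert-same s y (leaf _) = side-≤ s {y} (leaf tt) (leaf tt) ≤-refl
side-insert-same s y (node l b r) with ≤-<-connex y b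
... | inj₁ y≤b rewrite insert-≤ l r y≤b | side-≤ s (insert y l) r y≤b = side-insert-same true y l
... | inj₂ b<y rewrite insert-> l r b<y | side-> s l (insert y r) b<y = side-insert-same false y r

-- If y is not yet a label, the searches for y and y + 1 take the same path, and y + 1 then turns
-- right at the new node.
side-insert-pred : ∀ s y t → y ∉ inorder t → side s (suc y) (insert y t) ≡ false
side-insert-pred s y (leaf _) _ = side-> s {suc y} (leaf tt) (leaf tt) ≤-refl
side-insert-pred s y (node l b r) y∉ with ≤-<-connex y b
... | inj₁ y≤b rewrite insert-≤ l r y≤b
      | side-≤ s (insert y l) r (≤∧≢⇒< y≤b λ { refl → y∉ (∈-++⁺ʳ (inorder l) (here refl)) }) =
      side-insert-pred true y l (y∉ ∘ ∈-++⁺ˡ)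
... | inj₂ b<y rewrite insert-> l r b<y | side-> s l (insert y r) (m<n⇒m<1+n b<y) =
      side-insert-pred false y r (y∉ ∘ ∈-++⁺ʳ (inorder l) ∘ there)

module _ {a e : ℕ} where

  -- The paths of a and of `suc e` separate inside t, so the new node is not attached at the leaf
  -- where the search for a ends.
  side-insert-above : ∀ s {t x} → Meet a e t x → side s a (insert (suc e) t) ≡ side s a t
  side-insert-above s (here {l} {b} {r} a≤b b≤e)
    rewrite insert-> l r (s≤s b≤e) | side-≤ s l (insert (suc e) r) a≤b | side-≤ s l r a≤b = refl
  side-insert-above s (left {l} {b} {r} e<b m)
    with a≤b ← <⇒≤ (≤-<-trans (≤-trans (proj₁ (Meet-bounds m)) (proj₂ (Meet-bounds m))) e<b)
    rewrite insert-≤ l r e<b | side-≤ s (insert (suc e) l) r a≤b | side-≤ s l r a≤b = side-insert-above true m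
  side-insert-above s (right {l} {b} {r} b<a m)
    with b<e ← m≤n⇒m≤1+n (<-≤-trans b<a (≤-trans (proj₁ (Meet-bounds m)) (proj₂ (Meet-bounds m))))
    rewrite insert-> l r b<e | side-> s l (insert (suc e) r) b<a | side-> s l r b<a = side-insert-above false m

  side-insert-below : ∀ s {t x} → Meet a e t x → side s (suc e) (insert a t) ≡ side s (suc e) t
  side-insert-below s (here {l} {b} {r} a≤b b≤e)
    rewrite insert-≤ l r a≤b | side-> s (insert a l) r (s≤s b≤e) | side-> s l r (s≤s b≤e) = refl
  side-insert-below s (left {l} {b} {r} e<b m)
    with a≤b ← <⇒≤ (≤-<-trans (≤-trans (proj₁ (Meet-bounds m)) (proj₂ (Meet-bounds m))) e<b)
    rewrite insert-≤ l r a≤b | side-≤ s (insert a l) r e<b | side-≤ s l r e<b = side-insert-below true m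
  side-insert-below s (right {l} {b} {r} b<a m)
    with b<e ← m≤n⇒m≤1+n (<-≤-trans b<a (≤-trans (proj₁ (Meet-bounds m)) (proj₂ (Meet-bounds m))))
    rewrite insert-> l r b<a | side-> s l (insert a r) b<e | side-> s l r b<e = side-insert-below false m

-- Once y and y + 1 are in the tree, the side is settled: the path of a later letter z separates
-- from that of y + 1, because y lies in [z , y] if z ≤ y, and y + 1 in [y + 1 , z - 1] if z > y +
-- 1.
side-bst-++ : ∀ s y p q → y ∈ q → suc y ∈ q → y ∉ p → suc y ∉ p →
              side s (suc y) (bst (p ++ q)) ≡ side s (suc y) (bst q)
side-bst-++ s y []      q _ _ _ _ = refl
side-bst-++ s y (z ∷ p) q y∈ sy∈ y∉ sy∉ = trans step (side-bst-++ s y p q y∈ sy∈ (y∉ ∘ there) (sy∉ ∘ there))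
  where
  step : side s (suc y) (insert z (bst (p ++ q))) ≡ side s (suc y) (bst (p ++ q))
  step with ≤-<-connex z y
  ... | inj₁ z≤y = side-insert-below s (proj₂ (Meet-bst {w = p ++ q} (∈-++⁺ʳ p y∈) z≤y ≤-refl))
  ... | inj₂ y<z = beyond z (≤∧≢⇒< y<z (sy∉ ∘ here))
    where
    beyond : ∀ z → suc y < z → side s (suc y) (insert z (bst (p ++ q))) ≡ side s (suc y) (bst (p ++ q))
    beyond (suc e) (s≤s y<e) = side-insert-above s (proj₂ (Meet-bst {w = p ++ q} (∈-++⁺ʳ p sy∈) ≤-refl y<e))

Precedes : ℕ → ℕ → List ℕ → Set
Precedes x y w = ∃₂ λ p q → w ≡ p ++ x ∷ q × y ∈ q

precedes-connex : ∀ {x y w} → x ∈ w → y ∈ w → x ≢ y → Precedes x y w ⊎ Precedes y x w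
precedes-connex x∈ y∈ x≢y with ∈-∃++ x∈
... | p , q , refl with ∈-++⁻ p y∈
... | inj₂ (here refl) = contradiction refl x≢y
... | inj₂ (there y∈q) = inj₁ (p , q , refl , y∈q)
... | inj₁ y∈p with ∈-∃++ y∈p
... | p₀ , p₁ , refl = inj₂ (p₀ , p₁ ++ _ ∷ q , ++-assoc p₀ _ _ , ∈-++⁺ʳ p₁ (here refl))

precedes-reverse : ∀ {x y w} → Precedes x y w → Precedes y x (reverse w)
precedes-reverse {x} {y} (p , q , refl , y∈q) with ∈-∃++ y∈q
... | q₀ , q₁ , refl = reverse q₁ , reverse q₀ ++ x ∷ reverse p
  , trans (reverse-mid p x _) (trans (cong (_++ x ∷ reverse p) (reverse-mid q₀ y q₁)) (++-assoc (reverse q₁) _ _))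
  , ∈-++⁺ʳ (reverse q₀) (here refl)

Unique-precedes : ∀ {x y} p q → Unique (p ++ x ∷ q) → y ∈ q → x ∉ p × y ∉ p × x ∉ q
Unique-precedes {x} {y} p q u y∈q with ∈-∃++ y∈q
... | q₀ , q₁ , refl =
    proj₁ (Unique-mid p u)
  , proj₁ (Unique-mid (p ++ x ∷ q₀) (subst Unique (sym (++-assoc p _ _)) u)) ∘ ∈-++⁺ˡ
  , proj₂ (Unique-mid p u)

-- Of y and y + 1, the letter further left is inserted last and decides the letter of the canopy.
side-pred-first : ∀ {y w} s → Unique w → Precedes y (suc y) w → side s (suc y) (bst w) ≡ false
side-pred-first {y} s u (p , q , refl , sy∈q) with Unique-precedes p q u sy∈q
... | y∉p , sy∉p , y∉q = trans (side-bst-++ s y p (y ∷ q) (here refl) (there sy∈q) y∉p sy∉p)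
  (side-insert-pred s y (bst q) (y∉q ∘ ∈-resp-↭ (inorder-bst q)))

side-suc-first : ∀ {y w} s → Unique w → Precedes (suc y) y w → side s (suc y) (bst w) ≡ true
side-suc-first {y} s u (p , q , refl , y∈q) with Unique-precedes p q u y∈q
... | sy∉p , y∉p , _ = trans (side-bst-++ s y p (suc y ∷ q) (there y∈q) (here refl) y∉p sy∉p)
  (side-insert-same s (suc y) (bst q))

Unique-perm : ∀ {n w} → w ↭ range n → Unique w
Unique-perm {n} p = Unique-resp-↭ (↭-sym p) (range-unique n)

-- Reversing the word exchanges the order of y and y + 1, the only thing on which this side depends.
side-reverse : ∀ {n w} → w ↭ range (suc n) → ∀ {y} → y ∈ range n →
               side false (suc y) (bst (reverse w)) ≢ side false (suc y) (bst w)
side-reverse {n} {w} p {y} y∈ e with precedes-connex y∈w sy∈w (λ ())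
  where
  y∈w : y ∈ w
  y∈w = ∈-resp-↭ (↭-sym p) (subst (y ∈_) (sym (trans (cong range (+-comm 1 n)) (range-+ n 1))) (∈-++⁺ˡ y∈))
  sy∈w : suc y ∈ w
  sy∈w = ∈-resp-↭ (↭-sym p) (subst (suc y ∈_) (sym (range-suc n)) (there (∈-map⁺ suc y∈)))
... | inj₁ h = contradiction (trans (sym (side-suc-first false (Unique-perm (↭-reverse′ p)) (precedes-reverse h)))
                 (trans e (side-pred-first false (Unique-perm p) h))) λ ()
... | inj₂ h = contradiction (trans (sym (side-suc-first false (Unique-perm p) h))
                 (trans (sym e) (side-pred-first false (Unique-perm (↭-reverse′ p)) (precedes-reverse h)))) λ ()

pointwise-map : ∀ {f g : ℕ → Bool} xs → (∀ {y} → y ∈ xs → f y ≢ g y) → Pointwise _≢_ (map f xs) (map g xs)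
pointwise-map []       _ = []
pointwise-map (x ∷ xs) h = h (here refl) ∷ pointwise-map xs (h ∘ there)

shapes-twins : ∀ n {w} → w ↭ range n →
               Pointwise _≢_ (canopy (proj₁ (shapes w))) (canopy (proj₂ (shapes w)))
shapes-twins zero p with refl ← ↭-empty-inv p = []
shapes-twins (suc n) p rewrite canopy≡side n p | canopy≡side n (↭-reverse′ p) =
  pointwise-map (range n) (side-reverse p)

-- This places every permutation in the fibre of some index of the sums `𝐄` and `𝐇`.
twinOf : ∀ {n} (σ : 𝔖 n) → ∃ λ (J : Twin n) → 𝖯 σ ≡ trees J
twinOf {n} σ@(perm w p) = twin (proj₁ (shapes w)) (proj₂ (shapes w))
    (#nodes-bst (reverse w) (↭-reverse′ p)) (#nodes-bst w p) (shapes-twins n p)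
  , 𝖯≡shapes σ

-- The Baxter order on shifted shuffles

word-↭ : ∀ {n} (σ : 𝔖 n) → word σ ↭ range n
word-↭ {n} (perm w p) = recompute (w ↭? range n) p

-- An exchange survives if both letters are kept and becomes trivial otherwise, hence the closure in
-- the conclusion.
⋖-filter-map : ∀ {P : ℕ → Set} (P? : Decidable P) (f : ℕ → ℕ) →
               (∀ {a b} → P a → P b → a < b → f a < f b) →
               ∀ {w w′} → w ⋖ w′ → map f (filter P? w) ⋖* map f (filter P? w′)
⋖-filter-map P? f mono (exchange u {a} {b} v a<b) =
  subst₂ _⋖*_ (sym (split (a ∷ b ∷ v))) (sym (split (b ∷ a ∷ v))) (⋖*-++ˡ (map f (filter P? u)) swapped)
  where
  split : ∀ w → map f (filter P? (u ++ w)) ≡ map f (filter P? u) ++ map f (filter P? w)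
  split w = trans (cong (map f) (filter-++ P? u w)) (map-++ f (filter P? u) (filter P? w))
  swapped : map f (filter P? (a ∷ b ∷ v)) ⋖* map f (filter P? (b ∷ a ∷ v))
  swapped with P? a | P? b
  ... | yes pa | yes pb rewrite dec-true (P? a) pa | dec-true (P? b) pb =
    exchange [] (map f (filter P? v)) (mono pa pb a<b) ◅ ε
  ... | yes pa | no ¬pb rewrite dec-true (P? a) pa | dec-false (P? b) ¬pb = ε
  ... | no ¬pa | yes pb rewrite dec-false (P? a) ¬pa | dec-true (P? b) pb = ε
  ... | no ¬pa | no ¬pb rewrite dec-false (P? a) ¬pa | dec-false (P? b) ¬pb = ε

⋖*-filter-map : ∀ {P : ℕ → Set} (P? : Decidable P) (f : ℕ → ℕ) →
                (∀ {a b} → P a → P b → a < b → f a < f b) →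
                ∀ {w w′} → w ⋖* w′ → map f (filter P? w) ⋖* map f (filter P? w′)
⋖*-filter-map P? f mono = Star.kleisliStar (map f ∘ filter P?) (⋖-filter-map P? f mono)

⋖*-lows : ∀ m {w w′} → w ⋖* w′ → lows m w ⋖* lows m w′
⋖*-lows m s = subst₂ _⋖*_ (map-id _) (map-id _) (⋖*-filter-map (_≤? m) id (λ _ _ → id) s)

⋖*-rest : ∀ m {w w′} → w ⋖* w′ → rest m w ⋖* rest m w′
⋖*-rest m = ⋖*-filter-map (m <?_) (_∸ m) (λ m<a _ a<b → ∸-monoˡ-< a<b (<⇒≤ m<a))

⋖*-shift : ∀ m {w w′} → w ⋖* w′ → map (m +_) w ⋖* map (m +_) w′
⋖*-shift m = Star.gmap (map (m +_)) λ { (exchange u {a} {b} v a<b) →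
  subst₂ _⋖_ (sym (map-++ (m +_) u _)) (sym (map-++ (m +_) u _))
    (exchange (map (m +_) u) (map (m +_) v) (+-monoʳ-< m a<b)) }

≈ᴮ-shift : ∀ m {v w} → v ≈ᴮ w → map (m +_) v ≈ᴮ map (m +_) w
≈ᴮ-shift m {v} {w} (p , q) =
    subst₂ (λ v w → bst v ≡ bst w) (reverse-map (m +_) v) (reverse-map (m +_) w) (shifted (reverse v) (reverse w) p)
  , shifted v w q
  where
  shifted : ∀ v w → bst v ≡ bst w → bst (map (m +_) v) ≡ bst (map (m +_) w)
  shifted v w e = trans (bst-shift m v) (trans (cong (mapₙ (m +_)) e) (sym (bst-shift m w)))

interleaving-parts : ∀ m w → Interleaving (lows m w) (highs m w) w
interleaving-parts m []      = []
interleaving-parts m (a ∷ w) with ≤-<-connex a m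
... | inj₁ a≤m rewrite filter-accept (_≤? m) {xs = w} a≤m | filter-reject (m <?_) {xs = w} (≤⇒≯ a≤m) =
  consˡ (interleaving-parts m w)
... | inj₂ m<a rewrite filter-reject (_≤? m) {xs = w} (<⇒≱ m<a) | filter-accept (m <?_) {xs = w} m<a =
  consʳ (interleaving-parts m w)

parts-interleaving : ∀ {m v h w} → All (_≤ m) v → All (m <_) h → Interleaving v h w →
                     lows m w ≡ v × highs m w ≡ h
parts-interleaving _ _ [] = refl , refl
parts-interleaving {m} {w = a ∷ w} (a≤m ∷ p) q (consˡ i) with parts-interleaving p q i
... | e , f = trans (filter-accept (_≤? m) a≤m) (cong (a ∷_) e) , trans (filter-reject (m <?_) (≤⇒≯ a≤m)) f
parts-interleaving {m} {w = a ∷ w} p (m<a ∷ q) (consʳ i) with parts-interleaving p q i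
... | e , f = trans (filter-reject (_≤? m) (<⇒≱ m<a)) e , trans (filter-accept (m <?_) m<a) (cong (a ∷_) f)

range-≤ : ∀ {m v} → v ↭ range m → All (_≤ m) v
range-≤ {m} p = All.tabulate (proj₂ ∘ range-bounds m ∘ ∈-resp-↭ p)

shift-range-> : ∀ {m n w} → w ↭ range n → All (m <_) (map (m +_) w)
shift-range-> {m} {n} p = All.map⁺ (All.tabulate λ x∈ → m<m+n m (proj₁ (range-bounds n (∈-resp-↭ p x∈))))

parts-shuffle : ∀ {m n v h w} → v ↭ range m → h ↭ range n → Interleaving v (map (m +_) h) w →
                lows m w ≡ v × rest m w ≡ h
parts-shuffle {m} {h = h} p q i with parts-interleaving (range-≤ p) (shift-range-> q) i
... | e , f = e , trans (cong (map (_∸ m)) f) (map-+-∸ m h)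

Below-range : ∀ {m n v h} → v ↭ range m → h ↭ range n → Below v (map (m +_) h)
Below-range p q x∈ g∈ = ≤-<-trans (All.lookup (range-≤ p) x∈) (All.lookup (shift-range-> q) g∈)

++-shift-↭ : ∀ {m n v h} → v ↭ range m → h ↭ range n → v ++ map (m +_) h ↭ range (m + n)
++-shift-↭ {m} {n} p q = ↭-trans (++⁺ p (map⁺ (m +_) q)) (↭-reflexive (sym (range-+ m n)))

-- With _≼_ the order ≤P or its converse, the 𝐅 of the permutations w
-- with Reach _≼_ J w are the terms of 𝐄 J or of 𝐇 J.
Reach : (List ℕ → List ℕ → Set) → ∀ {n} → Twin n → List ℕ → Set
Reach _≼_ {n} J w = ∃₂ λ α ν → α ↭ range n × ν ↭ range n × α ≼ ν × shapes α ≡ trees J × shapes ν ≡ shapes w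

-- What the two equalities share: `cat v h` is the least shuffle for `_≼_`, namely v ++ h for 𝐄 and,
-- the order being reversed, h ++ v for 𝐇; `_⊗_` is its effect on P-symbols.
record Concatenation (_≼_ : List ℕ → List ℕ → Set) (_⊗_ : BT × BT → BT × BT → BT × BT) : Set where
  field
    ≼-trans      : ∀ {u v w} → u ≼ v → v ≼ w → u ≼ w
    ≼-lows       : ∀ m {w w′} → w ≼ w′ → lows m w ≼ lows m w′
    ≼-rest       : ∀ m {w w′} → w ≼ w′ → rest m w ≼ rest m w′
    ≼-shift      : ∀ m {w w′} → w ≼ w′ → map (m +_) w ≼ map (m +_) w′
    cat          : List ℕ → List ℕ → List ℕ
    cat-↭        : ∀ v h → cat v h ↭ v ++ h
    cat-mono     : ∀ {v v′ h h′} → v ≼ v′ → h ≼ h′ → cat v h ≼ cat v′ h′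
    cat-≼        : ∀ {v h w} → Below v h → Interleaving v h w → cat v h ≼ w
    shapes-cat   : ∀ v h → Below v h → shapes (cat v h) ≡ shapes v ⊗ shapes h
    shapes-parts : ∀ m n {w x y} → w ↭ range (m + n) → Sized m x → shapes w ≡ x ⊗ y →
                   shapes (lows m w) ≡ x × shapes (rest m w) ≡ y

concatenation-/ : Concatenation _⋖*_ _/²_
concatenation-/ = record
  { ≼-trans      = _◅◅_
  ; ≼-lows       = ⋖*-lows
  ; ≼-rest       = ⋖*-rest
  ; ≼-shift      = ⋖*-shift
  ; cat          = _++_
  ; cat-↭        = λ _ _ → ↭-refl
  ; cat-mono     = ⋖*-++
  ; cat-≼        = concat-⋖*-interleaving
  ; shapes-cat   = shapes-++-/
  ; shapes-parts = shapes-parts-/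
  }

concatenation-∖ : Concatenation (flip _⋖*_) _∖²_
concatenation-∖ = record
  { ≼-trans      = λ s t → t ◅◅ s
  ; ≼-lows       = λ m → ⋖*-lows m
  ; ≼-rest       = λ m → ⋖*-rest m
  ; ≼-shift      = λ m → ⋖*-shift m
  ; cat          = flip _++_
  ; cat-↭        = flip ++-comm
  ; cat-mono     = λ s t → ⋖*-++ t s
  ; cat-≼        = interleaving-⋖*-concat
  ; shapes-cat   = shapes-++-∖
  ; shapes-parts = shapes-parts-∖
  }

Sized-trees : ∀ {n} (J : Twin n) → Sized n (trees J)
Sized-trees (twin s t p q _) = recompute (_ ≟ _) p , recompute (_ ≟ _) q

module _ {_≼_ : List ℕ → List ℕ → Set} {_⊗_ : BT × BT → BT × BT → BT × BT}
         (C : Concatenation _≼_ _⊗_) {m n : ℕ} (J₀ : Twin m) (J₁ : Twin n) (J : Twin (m + n))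
         (J≡ : trees J ≡ trees J₀ ⊗ trees J₁) {w : List ℕ} (p : w ↭ range (m + n)) where

  open Concatenation C

  Reach-parts : Reach _≼_ J w → Reach _≼_ J₀ (lows m w) × Reach _≼_ J₁ (rest m w)
  Reach-parts (α , ν , α↭ , ν↭ , α≼ν , αJ , νw)
    with shapes-parts m n α↭ (Sized-trees J₀) (trans αJ J≡) | shapes⇒≈ᴮ ν↭ p νw
  ... | eL , eR | ν≈w =
      ( lows m α , lows m ν , lows-↭ m n α↭ , lows-↭ m n ν↭ , ≼-lows m α≼ν , eL
      , ≈ᴮ⇒shapes (≈ᴮ-lows m ν≈w))
    , ( rest m α , rest m ν , rest-↭ m n α↭ , rest-↭ m n ν↭ , ≼-rest m α≼ν , eR
      , trans (sym (shapes-highs m ν)) (trans (≈ᴮ⇒shapes (≈ᴮ-highs m ν≈w)) (shapes-highs m w)))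

  Reach-join : Reach _≼_ J₀ (lows m w) → Reach _≼_ J₁ (rest m w) → Reach _≼_ J w
  Reach-join (α , ν , α↭ , ν↭ , α≼ν , αJ , νw) (α′ , ν′ , α′↭ , ν′↭ , α′≼ν′ , α′J , ν′w)
    with lift-≈ᴮ lows<highs (Unique-perm ν↭) (Unique.map⁺ (+-cancelˡ-≡ m _ _) (Unique-perm ν′↭))
           (↭-trans (lows-↭ m n p) (↭-sym ν↭))
           (↭-trans (highs-↭ m n p) (map⁺ (m +_) (↭-sym ν′↭)))
           (shapes⇒≈ᴮ (lows-↭ m n p) ν↭ (sym νw))
           (subst (_≈ᴮ map (m +_) ν′) (sym (highs≡map-rest m w))
             (≈ᴮ-shift m (shapes⇒≈ᴮ (rest-↭ m n p) ν′↭ (sym ν′w))))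
           (interleaving-parts m w)
    where
    lows<highs : Below (lows m w) (highs m w)
    lows<highs x∈ g∈ = ≤-<-trans (All.lookup (All.all-filter (_≤? m) w) x∈)
                                 (All.lookup (All.all-filter (m <?_) w) g∈)
  ... | w′ , w≈w′ , i =
      cat α (map (m +_) α′) , w′
    , ↭-trans (cat-↭ α _) (++-shift-↭ α↭ α′↭)
    , ↭-trans (toPermutation i) (++-shift-↭ ν↭ ν′↭)
    -- The comparison passes through the concatenation of ν and the shifted ν′, of which w′ is a
    -- shuffle.
    , ≼-trans (cat-mono α≼ν (≼-shift m α′≼ν′)) (cat-≼ (Below-range ν↭ ν′↭) i)
    , trans (shapes-cat α _ (Below-range α↭ α′↭))
        (trans (cong₂ _⊗_ αJ (trans (shapes-shift m α′) α′J)) (sym J≡))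
    , sym (≈ᴮ⇒shapes w≈w′)

-- Lists of permutations and coefficients

-- `permutations` and `allTwins` attach proofs through `mapMaybe`. Forgetting these leaves a
-- filtered list of words or trees, from which absence of repetitions is inherited.
map-mapMaybe-filter : ∀ {A B : Set} {P : A → Set} (P? : Decidable P) (g : A → Maybe B) (f : B → A) →
                      (∀ a → Maybe.map f (g a) ≡ (if does (P? a) then just a else nothing)) →
                      ∀ as → map f (mapMaybe g as) ≡ filter P? as
map-mapMaybe-filter P? g f h []       = refl
map-mapMaybe-filter P? g f h (a ∷ as) with g a | does (P? a) | h a
... | just b  | true  | refl = cong (a ∷_) (map-mapMaybe-filter P? g f h as)
... | nothing | false | _    = map-mapMaybe-filter P? g f h as

words-unique : ∀ {A : Set} k {as : List A} → Unique as → Unique (words k as)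
words-unique zero    u = [] ∷ []
words-unique (suc k) u = Unique.cartesianProductWith⁺ _∷_ ∷-injective u (words-unique k u)

-- Stated on words because `coeff` compares words.
Distinct : ∀ {n} → List (𝔖 n) → Set
Distinct = AllPairs λ σ τ → word σ ≢ word τ

permutations-distinct : ∀ n → Distinct (permutations n)
permutations-distinct n = AllPairs.map⁻ (subst Unique
  (sym (map-mapMaybe-filter (_↭? range n) _ word section (words n (range n))))
  (Unique.filter⁺ (_↭? range n) (words-unique n (range-unique n))))
  where
  section : ∀ w → Maybe.map word (Maybe.map (λ p → perm w p) (dec⇒maybe (w ↭? range n)))
                  ≡ (if does (w ↭? range n) then just w else nothing)
  section w with w ↭? range n
  ... | yes _ = refl
  ... | no  _ = refl

∈-bounded : ∀ h t → #nodes t ≤ h → t ∈ bounded h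
∈-bounded zero    (leaf _)     _ = here refl
∈-bounded zero    (node l _ r) p = contradiction (n≤0⇒n≡0 p) (#nodes≢0 l r)
∈-bounded (suc h) (leaf _)     _ = here refl
∈-bounded (suc h) (node l _ r) p = there (∈-cartesianProductWith⁺ (λ l r → node l tt r)
  (∈-bounded h l (≤-trans (m≤m+n _ _) p′)) (∈-bounded h r (≤-trans (m≤n+m _ _) p′)))
  where
  p′ : #nodes l + #nodes r ≤ h
  p′ = ≤-pred (subst (_≤ suc h) (+-suc (#nodes l) (#nodes r)) p)

bounded-unique : ∀ h → Unique (bounded h)
bounded-unique zero    = [] ∷ []
bounded-unique (suc h) =
  All.tabulate (λ { t∈ refl → leaf∉ t∈ }) ∷
  Unique.cartesianProductWith⁺ (λ l r → node l tt r) node-injective (bounded-unique h) (bounded-unique h)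
  where
  leaf∉ : leaf tt ∉ cartesianProductWith (λ l r → node l tt r) (bounded h) (bounded h)
  leaf∉ t∈ with ∈-cartesianProductWith⁻ (λ l r → node l tt r) (bounded h) (bounded h) t∈
  ... | _ , _ , _ , _ , ()

isTwin? : ∀ n → Decidable (λ ((l , r) : BT × BT) →
  #nodes l ≡ n × #nodes r ≡ n × Pointwise _≢_ (canopy l) (canopy r))
isTwin? n (l , r) = (#nodes l ≟ n) ×-dec (#nodes r ≟ n)
  ×-dec Pointwise.decidable (λ s t → ¬? (s Bool.≟ t)) (canopy l) (canopy r)

trees-allTwins : ∀ n → map trees (allTwins n) ≡ filter (isTwin? n) (cartesianProduct (bounded n) (bounded n))
trees-allTwins n = map-mapMaybe-filter (isTwin? n) _ trees (λ x → section (isTwin? n x))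
  (cartesianProduct (bounded n) (bounded n))
  where
  section : ∀ {l r} (d : Dec (#nodes l ≡ n × #nodes r ≡ n × Pointwise _≢_ (canopy l) (canopy r))) →
            Maybe.map trees (Maybe.map (λ (p , q , c) → twin l r p q c) (dec⇒maybe d))
            ≡ (if does d then just (l , r) else nothing)
  section (yes _) = refl
  section (no _)  = refl

allTwins-distinct : ∀ n → AllPairs (λ J J′ → trees J ≢ trees J′) (allTwins n)
allTwins-distinct n = AllPairs.map⁻ (subst Unique (sym (trees-allTwins n))
  (Unique.filter⁺ (isTwin? n) (Unique.cartesianProduct⁺ (bounded-unique n) (bounded-unique n))))

∈-allTwins : ∀ {n} (J : Twin n) → J ∈ allTwins n
∈-allTwins {n} J@(twin l r p q c) with ∈-map⁻ trees (subst (trees J ∈_) (sym (trees-allTwins n))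
  (∈-filter⁺ (isTwin? n) (∈-cartesianProduct⁺ (∈-bounded n l (≤-reflexive p′)) (∈-bounded n r (≤-reflexive q′)))
    (p′ , q′ , c′)))
  where
  p′ : #nodes l ≡ n
  p′ = recompute (_ ≟ _) p
  q′ : #nodes r ≡ n
  q′ = recompute (_ ≟ _) q
  c′ : Pointwise _≢_ (canopy l) (canopy r)
  c′ = recompute (Pointwise.decidable (λ s t → ¬? (s Bool.≟ t)) (canopy l) (canopy r)) c
... | _ , J∈ , refl = J∈

-- As the alphabets are disjoint, the first letter tells from which word it was taken. This makes a
-- product of two 𝐅 multiplicity-free.
shuffles-distinct : ∀ (v h : List ℕ) → (∀ {x g} → x ∈ v → g ∈ h → x ≢ g) →
                    AllPairs (λ i j → proj₁ i ≢ proj₁ j) (shuffles v h)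
shuffles-distinct []      []      _ = [] ∷ []
shuffles-distinct []      (b ∷ h) d =
  AllPairs.map⁺ (AllPairs.map (_∘ ∷-injectiveʳ) (shuffles-distinct [] h λ ()))
shuffles-distinct (a ∷ v) []      d =
  AllPairs.map⁺ (AllPairs.map (_∘ ∷-injectiveʳ) (shuffles-distinct v [] λ _ ()))
shuffles-distinct (a ∷ v) (b ∷ h) d = AllPairs.++⁺
  (AllPairs.map⁺ (AllPairs.map (_∘ ∷-injectiveʳ) (shuffles-distinct v (b ∷ h) (d ∘ there))))
  (AllPairs.map⁺ (AllPairs.map (_∘ ∷-injectiveʳ) (shuffles-distinct (a ∷ v) h (λ x∈ → d x∈ ∘ there))))
  (All.map⁺ (All.tabulate λ _ → All.map⁺ (All.tabulate λ _ e →
    d (here refl) (here refl) (∷-injectiveˡ e))))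

∈-shuffles : ∀ {v h u : List ℕ} (i : Interleaving v h u) → (u , i) ∈ shuffles v h
∈-shuffles []                          = here refl
∈-shuffles {[]}    {b ∷ h} (consʳ i)   = ∈-map⁺ _ (∈-shuffles i)
∈-shuffles {a ∷ v} {[]}    (consˡ i)   = ∈-map⁺ _ (∈-shuffles i)
∈-shuffles {a ∷ v} {b ∷ h} (consˡ i)   = ∈-++⁺ˡ (∈-map⁺ _ (∈-shuffles i))
∈-shuffles {a ∷ v} {b ∷ h} (consʳ i)   = ∈-++⁺ʳ _ (∈-map⁺ _ (∈-shuffles i))

module _ {m n : ℕ} where

  shiftedShuffles-distinct : ∀ (σ : 𝔖 m) (ν : 𝔖 n) → Distinct (shiftedShuffles σ ν)
  shiftedShuffles-distinct σ@(perm v p) ν@(perm h q) = AllPairs.map⁺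
    (shuffles-distinct v (map (m +_) h) λ x∈ g∈ → <⇒≢ (Below-range (word-↭ σ) (word-↭ ν) x∈ g∈))

  ∈-shiftedShuffles⁻ : ∀ (σ : 𝔖 m) (ν : 𝔖 n) {ρ} → ρ ∈ shiftedShuffles σ ν →
                       Interleaving (word σ) (map (m +_) (word ν)) (word ρ)
  ∈-shiftedShuffles⁻ (perm v p) (perm h q) ρ∈ with ∈-map⁻ _ ρ∈
  ... | (_ , i) , _ , refl = i

  ∈-shiftedShuffles⁺ : ∀ (σ : 𝔖 m) (ν : 𝔖 n) {ρ} →
                       Interleaving (word σ) (map (m +_) (word ν)) (word ρ) → ρ ∈ shiftedShuffles σ ν
  ∈-shiftedShuffles⁺ (perm v p) (perm h q) i = ∈-map⁺ _ (∈-shuffles i)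

distinct-concatMap : ∀ {A : Set} {n} {f : A → List (𝔖 n)} {is} → (∀ i → Distinct (f i)) →
  AllPairs (λ i j → ∀ {σ τ} → σ ∈ f i → τ ∈ f j → word σ ≢ word τ) is → Distinct (concatMap f is)
distinct-concatMap d s = AllPairs.concat⁺ (All.map⁺ (All.tabulate λ {i} _ → d i))
  (AllPairs.map⁺ (AllPairs.map (λ h → All.tabulate λ σ∈ → All.tabulate λ τ∈ → h σ∈ τ∈) s))

∈-concatMap-at⁺ : ∀ {A B : Set} {f : A → List B} {is i y} → i ∈ is → y ∈ f i → y ∈ concatMap f is
∈-concatMap-at⁺ i∈ y∈ = ∈-concatMap⁺ _ (lose i∈ y∈)

∈-concatMap-at⁻ : ∀ {A B : Set} (f : A → List B) {is y} → y ∈ concatMap f is → ∃ λ i → i ∈ is × y ∈ f i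
∈-concatMap-at⁻ f y∈ = find (∈-concatMap⁻ f y∈)

-- Supports of sums of 𝐏 and of their products

fibre : ∀ {n} → Twin n → List (𝔖 n)
fibre {n} J = filter (λ σ → 𝖯 σ ≟² trees J) (permutations n)

-- The support of the sum of the 𝐏 J with Q J, listed in the very order in which that sum expands.
fibres : ∀ {n} {Q : Twin n → Set} → Decidable Q → List (𝔖 n)
fibres {n} Q? = concatMap fibre (filter Q? (allTwins n))

module _ {n : ℕ} {Q : Twin n → Set} (Q? : Decidable Q) where

  fibres-distinct : Distinct (fibres Q?)
  fibres-distinct = distinct-concatMap (λ J → AllPairs.filter⁺ (λ σ → 𝖯 σ ≟² trees J) (permutations-distinct n))
    (AllPairs.map (λ {J} {J′} → separate {J} {J′}) (AllPairs.filter⁺ Q? (allTwins-distinct n)))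
    where
    separate : ∀ {J J′ : Twin n} → trees J ≢ trees J′ → ∀ {σ τ} → σ ∈ fibre J → τ ∈ fibre J′ → word σ ≢ word τ
    separate {J} {J′} J≢ {σ} {τ} σ∈ τ∈ e = J≢ (begin
      trees J         ≡⟨ proj₂ (∈-filter⁻ (λ σ → 𝖯 σ ≟² trees J) {xs = permutations n} σ∈) ⟨
      𝖯 σ             ≡⟨ 𝖯≡shapes σ ⟩
      shapes (word σ) ≡⟨ cong shapes e ⟩
      shapes (word τ) ≡⟨ 𝖯≡shapes τ ⟨
      𝖯 τ             ≡⟨ proj₂ (∈-filter⁻ (λ σ → 𝖯 σ ≟² trees J′) {xs = permutations n} τ∈) ⟩
      trees J′        ∎)
      where open ≡-Reasoning

  ∈-fibres⁺ : ∀ {σ J} → Q J → 𝖯 σ ≡ trees J → σ ∈ fibres Q?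
  ∈-fibres⁺ {σ} {J} q e = ∈-concatMap-at⁺ {f = fibre} (∈-filter⁺ Q? (∈-allTwins J) q)
    (∈-filter⁺ (λ σ → 𝖯 σ ≟² trees J) (∈-permutations σ) e)

  ∈-fibres⁻ : ∀ {σ} → σ ∈ fibres Q? → ∃ λ J → Q J × 𝖯 σ ≡ trees J
  ∈-fibres⁻ {σ} σ∈ with ∈-concatMap-at⁻ fibre σ∈
  ... | J , J∈ , σ∈J = J , proj₂ (∈-filter⁻ Q? {xs = allTwins n} J∈)
    , proj₂ (∈-filter⁻ (λ σ → 𝖯 σ ≟² trees J) {xs = permutations n} σ∈J)

products : ∀ {m n} → List (𝔖 m) → List (𝔖 n) → List (𝔖 (m + n))
products σs νs = concatMap (λ σ → concatMap (shiftedShuffles σ) νs) σs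

module _ {m n : ℕ} where

  -- A shifted shuffle determines its factors through `lows` and `rest`, so different pairs
  -- contribute disjoint lists.
  products-distinct : ∀ {σs : List (𝔖 m)} {νs : List (𝔖 n)} → Distinct σs → Distinct νs →
                      Distinct (products σs νs)
  products-distinct {νs = νs} dσ dν =
    distinct-concatMap (λ σ → distinct-concatMap (shiftedShuffles-distinct σ)
      (AllPairs.map (λ {ν} {ν′} ν≢ {ρ} {π} ρ∈ π∈ e → ν≢ (begin
          word ν          ≡⟨ proj₂ (parts σ ν ρ∈) ⟨
          rest m (word ρ) ≡⟨ cong (rest m) e ⟩
          rest m (word π) ≡⟨ proj₂ (parts σ ν′ π∈) ⟩
          word ν′         ∎)) dν))
      (AllPairs.map (λ {σ} {σ′} σ≢ {ρ} {π} ρ∈ π∈ e →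
        let ν  , _ , ρ∈′ = ∈-concatMap-at⁻ (shiftedShuffles σ) {νs} ρ∈
            ν′ , _ , π∈′ = ∈-concatMap-at⁻ (shiftedShuffles σ′) {νs} π∈
        in σ≢ (begin
          word σ          ≡⟨ proj₁ (parts σ ν ρ∈′) ⟨
          lows m (word ρ) ≡⟨ cong (lows m) e ⟩
          lows m (word π) ≡⟨ proj₁ (parts σ′ ν′ π∈′) ⟩
          word σ′         ∎)) dσ)
    where
    open ≡-Reasoning
    parts : ∀ (σ : 𝔖 m) (ν : 𝔖 n) {ρ} → ρ ∈ shiftedShuffles σ ν →
            lows m (word ρ) ≡ word σ × rest m (word ρ) ≡ word ν
    parts σ ν ρ∈ = parts-shuffle (word-↭ σ) (word-↭ ν) (∈-shiftedShuffles⁻ σ ν ρ∈)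

  lowPerm : 𝔖 (m + n) → 𝔖 m
  lowPerm (perm w p) = perm (lows m w) (lows-↭ m n p)

  restPerm : 𝔖 (m + n) → 𝔖 n
  restPerm (perm w p) = perm (rest m w) (rest-↭ m n p)

  module _ (σs : List (𝔖 m)) (νs : List (𝔖 n)) where

    ∈-products⁺ : ∀ ρ → lowPerm ρ ∈ σs → restPerm ρ ∈ νs → ρ ∈ products σs νs
    ∈-products⁺ ρ σ∈ ν∈ = ∈-concatMap-at⁺ {f = λ σ → concatMap (shiftedShuffles σ) νs} σ∈
      (∈-concatMap-at⁺ {f = shiftedShuffles (lowPerm ρ)} ν∈ (∈-shiftedShuffles⁺ (lowPerm ρ) (restPerm ρ)
        (subst (λ h → Interleaving (lows m (word ρ)) h (word ρ)) (highs≡map-rest m (word ρ))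
          (interleaving-parts m (word ρ)))))

    ∈-products⁻ : ∀ ρ → ρ ∈ products σs νs → lowPerm ρ ∈ σs × restPerm ρ ∈ νs
    ∈-products⁻ ρ ρ∈ with ∈-concatMap-at⁻ (λ σ → concatMap (shiftedShuffles σ) νs) {σs} ρ∈
    ... | σ , σ∈ , ρ∈′ with ∈-concatMap-at⁻ (shiftedShuffles σ) {νs} ρ∈′
    ... | ν , ν∈ , ρ∈″ with parts-shuffle (word-↭ σ) (word-↭ ν) (∈-shiftedShuffles⁻ σ ν ρ∈″)
    -- Equality of words identifies the permutations, since `isPerm` is irrelevant.
    ... | refl , refl = σ∈ , ν∈

up down : ∀ {n} → Twin n → List (𝔖 n)
up J   = fibres (λ J′ → J ≤B? J′)
down J = fibres (λ J′ → J′ ≤B? J)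

-- The summand that contains σ is indexed by its own P-symbol, supplied by `twinOf`; α and ν then
-- witness the order.
∈-up⁺ : ∀ {n} (J : Twin n) σ → Reach _⋖*_ J (word σ) → σ ∈ up J
∈-up⁺ J σ (α , ν , α↭ , ν↭ , α≼ν , αJ , νσ) with twinOf σ
... | J′ , σJ′ = ∈-fibres⁺ (λ J′ → J ≤B? J′) {J = J′} (perm α α↭ , perm ν ν↭ , α≼ν , trans (𝖯≡shapes (perm α α↭)) αJ
    , trans (𝖯≡shapes (perm ν ν↭)) (trans νσ (trans (sym (𝖯≡shapes σ)) σJ′))) σJ′

∈-up⁻ : ∀ {n} (J : Twin n) σ → σ ∈ up J → Reach _⋖*_ J (word σ)
∈-up⁻ J σ σ∈ with ∈-fibres⁻ (λ J′ → J ≤B? J′) σ∈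
... | J′ , (α , ν , α≼ν , αJ , νJ′) , σJ′ = word α , word ν , word-↭ α , word-↭ ν , α≼ν
    , trans (sym (𝖯≡shapes α)) αJ
    , trans (sym (𝖯≡shapes ν)) (trans νJ′ (trans (sym σJ′) (𝖯≡shapes σ)))

∈-down⁺ : ∀ {n} (J : Twin n) σ → Reach (flip _⋖*_) J (word σ) → σ ∈ down J
∈-down⁺ J σ (α , ν , α↭ , ν↭ , α≼ν , αJ , νσ) with twinOf σ
... | J′ , σJ′ = ∈-fibres⁺ (λ J′ → J′ ≤B? J) {J = J′} (perm ν ν↭ , perm α α↭ , α≼ν
    , trans (𝖯≡shapes (perm ν ν↭)) (trans νσ (trans (sym (𝖯≡shapes σ)) σJ′))
    , trans (𝖯≡shapes (perm α α↭)) αJ) σJ′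

∈-down⁻ : ∀ {n} (J : Twin n) σ → σ ∈ down J → Reach (flip _⋖*_) J (word σ)
∈-down⁻ J σ σ∈ with ∈-fibres⁻ (λ J′ → J′ ≤B? J) σ∈
... | J′ , (ν , α , α≼ν , νJ′ , αJ) , σJ′ = word α , word ν , word-↭ α , word-↭ ν , α≼ν
    , trans (sym (𝖯≡shapes α)) αJ
    , trans (sym (𝖯≡shapes ν)) (trans νJ′ (trans (sym σJ′) (𝖯≡shapes σ)))

concatMap-concatMap : ∀ {a b c} {A : Set a} {B : Set b} {C : Set c} (g : B → List C) (f : A → List B) as →
                      concatMap (concatMap g ∘ f) as ≡ concatMap g (concatMap f as)
concatMap-concatMap g f []       = refl
concatMap-concatMap g f (a ∷ as) =
  trans (cong (concatMap g (f a) ++_) (concatMap-concatMap g f as)) (sym (concatMap-++ g (f a) (concatMap f as)))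

-- From supports to coefficients

module _ {c ℓ₁ ℓ₂ : Level} (𝕂 : HeytingField c ℓ₁ ℓ₂) where

  open HeytingField 𝕂 using (_≈_; 0#; 1#)
  module 𝕂 = HeytingField 𝕂
  open OverField 𝕂

  -- Coefficients only need to be ≈ 1, since a product yields `(1# * 1#) * 1#`. Words are compared
  -- because each term carries its own size.
  Sums : ∀ {n} → FQSym → List (𝔖 n) → Set (c Level.⊔ ℓ₁)
  Sums = Pointwise λ (a , _ , σ) ρ → a ≈ 1# × word σ ≡ word ρ

  Sums-𝐅 : ∀ {n} (σs : List (𝔖 n)) → Sums (∑ σs 𝐅) σs
  Sums-𝐅 []       = []
  Sums-𝐅 (σ ∷ σs) = (𝕂.refl , refl) ∷ Sums-𝐅 σs

  Sums-⊙ : ∀ {n a} {x : FQSym} {σs : List (𝔖 n)} → a ≈ 1# → Sums x σs → Sums (a ⊙ x) σs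
  Sums-⊙ a≈1 []             = []
  Sums-⊙ a≈1 ((b≈1 , e) ∷ s) = (𝕂.trans (𝕂.*-cong a≈1 b≈1) (𝕂.*-identityˡ 1#) , e) ∷ Sums-⊙ a≈1 s

  Sums-· : ∀ {m n} (σs : List (𝔖 m)) (νs : List (𝔖 n)) → Sums (∑ σs 𝐅 · ∑ νs 𝐅) (products σs νs)
  Sums-· []       νs = []
  Sums-· (σ ∷ σs) νs = Pointwise.++⁺ (inner νs) (Sums-· σs νs)
    where
    inner : ∀ νs → Sums (concatMap (λ (b , _ , ν) → (1# 𝕂.* b) ⊙ ∑ (shiftedShuffles σ ν) 𝐅) (∑ νs 𝐅))
                        (concatMap (shiftedShuffles σ) νs)
    inner []       = []
    inner (ν ∷ νs) = Pointwise.++⁺ (Sums-⊙ (𝕂.*-identityˡ 1#) (Sums-𝐅 (shiftedShuffles σ ν))) (inner νs)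

  Occurs : ∀ {k n} → 𝔖 k → List (𝔖 n) → Set
  Occurs σ = Any (λ ρ → word ρ ≡ word σ)

  coeff-absent : ∀ {k n x} {ρs : List (𝔖 n)} (σ : 𝔖 k) → Sums x ρs → ¬ Occurs σ ρs → coeff x σ ≈ 0#
  coeff-absent σ []                                  _ = 𝕂.refl
  coeff-absent σ (_∷_ {x = _ , _ , τ} (_ , e) s) ∉
    rewrite dec-false (word τ ≟ʷ word σ) (λ e′ → ∉ (here (trans (sym e) e′))) =
    coeff-absent σ s (∉ ∘ there)

  coeff-present : ∀ {k n x} {ρs : List (𝔖 n)} (σ : 𝔖 k) → Sums x ρs → Distinct ρs → Occurs σ ρs → coeff x σ ≈ 1#
  coeff-present σ (_∷_ {x = _ , _ , τ} (a≈1 , e) s) (ρ∉ ∷ d) (here e′)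
    rewrite dec-true (word τ ≟ʷ word σ) (trans e e′) =
    𝕂.trans (𝕂.+-cong a≈1 (coeff-absent σ s λ o →
      let _ , ρ′∈ , e″ = find o in All.lookup ρ∉ ρ′∈ (trans e′ (sym e″)))) (𝕂.+-identityʳ 1#)
  coeff-present σ (_∷_ {x = _ , _ , τ} (a≈1 , e) s) (ρ∉ ∷ d) (there o)
    rewrite dec-false (word τ ≟ʷ word σ) (λ e′ →
      let _ , ρ′∈ , e″ = find o in All.lookup ρ∉ ρ′∈ (trans (sym e) (trans e′ (sym e″)))) =
    coeff-present σ s d o

  -- Without repetitions every coefficient is 0 or 1, so mutual inclusion of the supports suffices.
  Sums⇒≋ : ∀ {n x y} {σs τs : List (𝔖 n)} → Sums x σs → Sums y τs → Distinct σs → Distinct τs →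
           (∀ ρ → ρ ∈ σs → ρ ∈ τs) → (∀ ρ → ρ ∈ τs → ρ ∈ σs) → x ≋ y
  Sums⇒≋ {σs = σs} {τs} sx sy dσ dτ σ⊆τ τ⊆σ π with any? (λ ρ → word ρ ≟ʷ word π) σs
  ... | yes o = 𝕂.trans (coeff-present π sx dσ o) (𝕂.sym (coeff-present π sy dτ (move-to o)))
    where
    move-to : Occurs π σs → Occurs π τs
    move-to o = let ρ , ρ∈ , e = find o in lose (σ⊆τ ρ ρ∈) e
  ... | no ∉  = 𝕂.trans (coeff-absent π sx ∉) (𝕂.sym (coeff-absent π sy (∉ ∘ move-back)))
    where
    move-back : Occurs π τs → Occurs π σs
    move-back o = let ρ , ρ∈ , e = find o in lose (τ⊆σ ρ ρ∈) e

  -- Common to 𝐄 and 𝐇: after flattening the sums of 𝐏 into sums of 𝐅, what remains is the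
  -- combinatorial equality of supports.
  fibres-product : ∀ {m n} {Q₀ : Twin m → Set} {Q₁ : Twin n → Set} {Q : Twin (m + n) → Set}
    (Q₀? : Decidable Q₀) (Q₁? : Decidable Q₁) (Q? : Decidable Q) →
    (∀ ρ → ρ ∈ products (fibres Q₀?) (fibres Q₁?) → ρ ∈ fibres Q?) →
    (∀ ρ → ρ ∈ fibres Q? → ρ ∈ products (fibres Q₀?) (fibres Q₁?)) →
    (∑ (filter Q₀? (allTwins m)) 𝐏 · ∑ (filter Q₁? (allTwins n)) 𝐏) ≋ ∑ (filter Q? (allTwins (m + n))) 𝐏
  fibres-product {m} {n} Q₀? Q₁? Q? ⊆ ⊇
    rewrite concatMap-concatMap 𝐅 fibre (filter Q₀? (allTwins m))
          | concatMap-concatMap 𝐅 fibre (filter Q₁? (allTwins n))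
          | concatMap-concatMap 𝐅 fibre (filter Q? (allTwins (m + n)))
    = Sums⇒≋ (Sums-· (fibres Q₀?) (fibres Q₁?)) (Sums-𝐅 (fibres Q?))
        (products-distinct (fibres-distinct Q₀?) (fibres-distinct Q₁?)) (fibres-distinct Q?) ⊆ ⊇

corollary6p9 : ∀ {c ℓ₁ ℓ₂} (𝕂 : HeytingField c ℓ₁ ℓ₂) → CharacteristicZero 𝕂 →
    let open OverField 𝕂 in
    ∀ {m n} (J₀ : Twin m) (J₁ : Twin n) →
    (𝐄 J₀ · 𝐄 J₁ ≋ 𝐄 (J₀ / J₁)) × (𝐇 J₀ · 𝐇 J₁ ≋ 𝐇 (J₀ ∖ J₁))
corollary6p9 𝕂 _ {m} {n} J₀ J₁ =
    fibres-product 𝕂 (λ J → J₀ ≤B? J) (λ J → J₁ ≤B? J) (λ J → (J₀ / J₁) ≤B? J)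
      (λ ρ ρ∈ → let σ∈ , ν∈ = ∈-products⁻ (up J₀) (up J₁) ρ ρ∈ in
        ∈-up⁺ (J₀ / J₁) ρ (Reach-join concatenation-/ J₀ J₁ (J₀ / J₁) refl (word-↭ ρ)
          (∈-up⁻ J₀ (lowPerm ρ) σ∈) (∈-up⁻ J₁ (restPerm ρ) ν∈)))
      (λ ρ ρ∈ → let r₀ , r₁ = Reach-parts concatenation-/ J₀ J₁ (J₀ / J₁) refl (word-↭ ρ)
                                (∈-up⁻ (J₀ / J₁) ρ ρ∈) in
        ∈-products⁺ (up J₀) (up J₁) ρ (∈-up⁺ J₀ (lowPerm ρ) r₀) (∈-up⁺ J₁ (restPerm ρ) r₁))
  , fibres-product 𝕂 (λ J → J ≤B? J₀) (λ J → J ≤B? J₁) (λ J → J ≤B? (J₀ ∖ J₁))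
      (λ ρ ρ∈ → let σ∈ , ν∈ = ∈-products⁻ (down J₀) (down J₁) ρ ρ∈ in
        ∈-down⁺ (J₀ ∖ J₁) ρ (Reach-join concatenation-∖ J₀ J₁ (J₀ ∖ J₁) refl (word-↭ ρ)
          (∈-down⁻ J₀ (lowPerm ρ) σ∈) (∈-down⁻ J₁ (restPerm ρ) ν∈)))
      (λ ρ ρ∈ → let r₀ , r₁ = Reach-parts concatenation-∖ J₀ J₁ (J₀ ∖ J₁) refl (word-↭ ρ)
                                (∈-down⁻ (J₀ ∖ J₁) ρ ρ∈) in
        ∈-products⁺ (down J₀) (down J₁) ρ (∈-down⁺ J₀ (lowPerm ρ) r₀) (∈-down⁺ J₁ (restPerm ρ) r₁))
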